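{- Let $n\geq 3$ and let $G=(V,E)$ be a cycle graph with $n$ vertices, with a fixed partition $E=E_{\mathrm{refl}}\sqcup E_{\mathrm{refr}}$ into reflection edges and refraction edges such that $|E_{\mathrm{refr}}|$ is even. Let $\sigma\in\Lambda_G$. Then the orbit of $\Theta$ containing $(\sigma,1,1)$ has size \[\frac{n\,p_\sigma}{\gcd(n,\mu_\sigma)}\Big(\mu_\sigma m_\sigma+(n-\mu_\sigma)(n-1-m_\sigma)\Big).\]
   Context: For $i\in\mathbb{Z}/n\mathbb{Z}$, $s_i$ is the transposition of $\mathbb{Z}/n\mathbb{Z}$ swapping $i$ and $i+1$. A labeling of $G$ is a bijection $V\to\mathbb{Z}/n\mathbb{Z}$; $\Lambda_G$ is the set of labelings. Let $\Xi_G=\Lambda_G\times\mathbb{Z}/n\mathbb{Z}\times\{\pm1\}$ and define $\Theta(\sigma,i,\epsilon)=(s_i\circ\sigma,i+\epsilon,\epsilon)$ if $\{\sigma^{ -1}(i),\sigma^{ -1}(i+1)\}\notin E$; $(\sigma,i+\epsilon,\epsilon)$ if $\{\sigma^{ -1}(i),\sigma^{ -1}(i+1)\}\in E_{\mathrm{refl}}$; $(s_i\circ\sigma,i-\epsilon,-\epsilon)$ if $\{\sigma^{ -1}(i),\sigma^{ -1}(i+1)\}\in E_{\mathrm{refr}}$. Given $\sigma$, name the vertices of $G$ as $v_1,\dots,v_n$ in order along the cycle (so the edges are $\{v_k,v_{k+1}\}$ and $\{v_n,v_1\}$), choosing the starting vertex and direction so that $\sigma(v_n)=1$ and $\sigma(v_1)<\sigma(v_{n-1})$,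 where $\mathbb{Z}/n\mathbb{Z}$ is identified with $\{1,\dots,n\}$. For distinct $x,y\in\mathbb{Z}/n\mathbb{Z}$ let $\mathrm{arc}(x,y)=\{x+1,x+2,\dots,y-1\}\subseteq\mathbb{Z}/n\mathbb{Z}$ (the elements strictly between $x$ and $y$ going upward cyclically). Let $a_0=1+|\{k\in\{1,\dots,n-1\}:\sigma(v_k)\in\mathrm{arc}(\sigma(v_{n-1}),\sigma(v_1))\}|$ and, for $1\le j\le n-2$, $a_j=1+|\{k\in\{1,\dots,n-1\}:\sigma(v_k)\in\mathrm{arc}(\sigma(v_j),\sigma(v_{j+1}))\}|$. Extend to an infinite sequence $(a_\beta)_{\beta\ge0}$ by $a_{j+n-1}=a_j$. Then $\sum_{\ell=0}^{n-2}a_\ell=m_\sigma(n-1)$ for a positive integer $m_\sigma$; let $p_\sigma$ be the (minimal) period of $(a_\beta)_{\beta\ge0}$. Since $|E_{\mathrm{refr}}|$ is even, there is a unique partition $V=Y_1\sqcup Y_{ -1}$ such that every refraction edge has one endpoint in each part, every reflection edge has both endpoints in the same part, and $v_n\in Y_1$; let $\mu_\sigma=|Y_1|$. -}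

module Defs where

open import Data.Nat as ℕ using (ℕ; zero; suc; _+_; _*_; _∸_; _≤_; _<_; _<ᵇ_; z≤n; s≤s; NonZero)
open import Data.Nat.GCD using (gcd; gcd[m,n]≢0)
open import Data.Fin as Fin using (Fin; toℕ; fromℕ; fromℕ<; inject₁)
open import Data.Fin.Permutation using (Permutation′; _⟨$⟩ʳ_; _⟨$⟩ˡ_; _∘ₚ_; transpose)
open import Data.Bool using (Bool; true; false; if_then_else_; _∧_; _∨_)
open import Data.List using (List; map; applyUpTo; allFin)
open import Data.Nat.ListAction using (sum)
open import Data.Maybe using (Maybe; just; nothing)
open import Data.Product using (_×_; _,_)
open import Data.Sum using (inj₁)
open import Relation.Nullary using (¬_; yes; no)
open import Relation.Binary.PropositionalEquality using (_≡_)

-- Conventions.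
-- Z/nZ is Fin n, where the label k ∈ {1,…,n} of the paper is the
-- element with toℕ = k - 1.  The cycle graph G has vertex set Fin n,
-- edges {k, k+1 (mod n)} for k : Fin n (edge number k).  A partition
-- E = E_refl ⊔ E_refr is a function  refr : Fin n → Bool  telling
-- whether edge number k is a refraction edge.

sucMod : ∀ {n} → Fin n → Fin n
sucMod {suc n} i with toℕ i ℕ.<? n
... | yes p = fromℕ< (s≤s p)
... | no  _ = Fin.zero

predMod : ∀ {n} → Fin n → Fin n
predMod {suc n} Fin.zero    = fromℕ n
predMod {suc n} (Fin.suc i) = inject₁ i

-- the element 1 of Z/nZ (toℕ = 0)
one : ∀ {n} → 3 ≤ n → Fin n
one {suc n} _ = Fin.zero

data Sgn : Set where
  pos neg : Sgn

negate : Sgn → Sgn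
negate pos = neg
negate neg = pos

step : ∀ {n} → Sgn → Fin n → Fin n
step pos = sucMod
step neg = predMod

steps : ∀ {n} → Sgn → ℕ → Fin n → Fin n
steps ε zero    i = i
steps ε (suc k) i = step ε (steps ε k i)

-- classification of a pair of vertices:
--   nothing       : not an edge
--   just false    : reflection edge
--   just true     : refraction edge
edgeKind : ∀ {n} → (Fin n → Bool) → Fin n → Fin n → Maybe Bool
edgeKind refr a b with b Fin.≟ sucMod a
... | yes _ = just (refr a)
... | no _ with a Fin.≟ sucMod b
...   | yes _ = just (refr b)
...   | no _  = nothing

-- Labelings: bijections V → Z/nZ.  Ξ_G = Λ_G × Z/nZ × {±1}.
Ξ : ℕ → Set
Ξ n = Permutation′ n × Fin n × Sgn

-- s_i ∘ σ   (∘ₚ is diagrammatic: first σ, then the transposition)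
sApply : ∀ {n} → Fin n → Permutation′ n → Permutation′ n
sApply i σ = σ ∘ₚ transpose i (sucMod i)

Θ : ∀ {n} → (Fin n → Bool) → Ξ n → Ξ n
Θ refr (σ , i , ε) with edgeKind refr (σ ⟨$⟩ˡ i) (σ ⟨$⟩ˡ sucMod i)
... | nothing    = (sApply i σ , step ε i , ε)
... | just false = (σ , step ε i , ε)
... | just true  = (sApply i σ , step (negate ε) i , negate ε)

iter : ∀ {A : Set} → (A → A) → ℕ → A → A
iter f zero    x = x
iter f (suc k) x = f (iter f k x)

_≈Ξ_ : ∀ {n} → Ξ n → Ξ n → Set
_≈Ξ_ {n} (σ , i , ε) (τ , j , δ) = ((v : Fin n) → σ ⟨$⟩ʳ v ≡ τ ⟨$⟩ʳ v) × i ≡ j × ε ≡ δ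

-- N is the size of the Θ-orbit of x (Θ is a bijection of the finite set
-- Ξ, so the orbit of x is a cycle and its size is the least N > 0 with
-- Θ^N x = x).
OrbitSize : ∀ {n} → (Fin n → Bool) → Ξ n → ℕ → Set
OrbitSize refr x N =
  0 < N × iter (Θ refr) N x ≈Ξ x ×
  ((k : ℕ) → 0 < k → k < N → ¬ (iter (Θ refr) k x ≈Ξ x))

count : ∀ {n} → (Fin n → Bool) → ℕ
count {n} P = sum (map (λ k → if P k then 1 else 0) (allFin n))

vLast : ∀ {n} → 3 ≤ n → Permutation′ n → Fin n
vLast hn σ = σ ⟨$⟩ˡ one hn

-- direction: chosen so that σ(v_1) < σ(v_{n-1})
dir : ∀ {n} → 3 ≤ n → Permutation′ n → Sgn
dir hn σ =
  if toℕ (σ ⟨$⟩ʳ sucMod (vLast hn σ)) <ᵇ toℕ (σ ⟨$⟩ʳ predMod (vLast hn σ))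
  then pos else neg

-- v_k  (k = 1, …, n; v_n = vLast)
vert : ∀ {n} → 3 ≤ n → Permutation′ n → ℕ → Fin n
vert hn σ k = steps (dir hn σ) k (vLast hn σ)

-- σ(v_k) as a natural number 0 … n-1  (paper's value minus 1)
lab : ∀ {n} → 3 ≤ n → Permutation′ n → ℕ → ℕ
lab hn σ k = toℕ (σ ⟨$⟩ʳ vert hn σ k)

-- z ∈ arc(x, y) = {x+1, …, y-1} cyclically  (for x ≠ y)
inArc : ℕ → ℕ → ℕ → Bool
inArc x y z = if x <ᵇ y then ((x <ᵇ z) ∧ (z <ᵇ y)) else ((x <ᵇ z) ∨ (z <ᵇ y))

arcCount : ∀ {n} → 3 ≤ n → Permutation′ n → ℕ → ℕ → ℕ
arcCount {n} hn σ x y =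
  1 + sum (map (λ k → if inArc x y (lab hn σ k) then 1 else 0)
               (applyUpTo suc (n ∸ 1)))

aFin : ∀ {n} → 3 ≤ n → Permutation′ n → ℕ → ℕ
aFin {n} hn σ zero    = arcCount hn σ (lab hn σ (n ∸ 1)) (lab hn σ 1)
aFin {n} hn σ (suc j) = arcCount hn σ (lab hn σ (suc j)) (lab hn σ (suc (suc j)))

nz-pred : ∀ {n} → 3 ≤ n → NonZero (n ∸ 1)
nz-pred {suc (suc (suc k))} _ = _
nz-pred {suc zero} (s≤s ())
nz-pred {suc (suc zero)} (s≤s (s≤s ()))

aSeq : ∀ {n} → 3 ≤ n → Permutation′ n → ℕ → ℕ
aSeq {n} hn σ β = aFin hn σ (ℕ._%_ β (n ∸ 1) {{nz-pred hn}})

aSum : ∀ {n} → 3 ≤ n → Permutation′ n → ℕ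
aSum {n} hn σ = sum (applyUpTo (aFin hn σ) (n ∸ 1))

IsPeriod : (ℕ → ℕ) → ℕ → Set
IsPeriod a p = (β : ℕ) → a (β + p) ≡ a β

IsMinimalPeriod : (ℕ → ℕ) → ℕ → Set
IsMinimalPeriod a p = 0 < p × IsPeriod a p × ((q : ℕ) → 0 < q → q < p → ¬ IsPeriod a q)

-- Y : V → Bool encodes the partition V = Y_1 ⊔ Y_{-1} (true ↦ Y_1):
-- every refraction edge joins the two parts, every reflection edge
-- stays in one part, and v_n ∈ Y_1.
IsSignPartition : ∀ {n} → 3 ≤ n → (Fin n → Bool) → Permutation′ n → (Fin n → Bool) → Set
IsSignPartition {n} hn refr σ Y =
  Y (vLast hn σ) ≡ true ×
  ((k : Fin n) → (refr k ≡ true → ¬ (Y k ≡ Y (sucMod k))) × (refr k ≡ false → Y k ≡ Y (sucMod k)))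

nz-gcd : ∀ {n} → 3 ≤ n → (μ : ℕ) → NonZero (gcd n μ)
nz-gcd {suc k} _ μ = ℕ.≢-nonZero (gcd[m,n]≢0 (suc k) μ (inj₁ (λ ())))

-- Θ carries one vertex at a time around ℤ/n, past its non-neighbours, until it meets a neighbour, which takes over.
-- The vertices thus take over in the order v_n , v_1 , v_2 , … , and the arriving vertex replaces the new carrier in
-- the cyclic order of the n − 1 vertices at rest.  So the places q_1 , … , q_{n-1} of the vertices in that order are
-- fixed, and the β-th carrier starts from q_β (β mod n − 1) and ends at q_{β+1}: upwards in a_β steps if it lies
-- in Y_1, downwards in n − 1 − a_β steps otherwise.  A state recurs up to rotation exactly after a multiple of n p
-- takeovers.  As p ∣ n − 1, such a round pairs every vertex with every a_β , β < p, so it takes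
-- p (μ m + (n − μ)(n − 1 − m)) steps and rotates the labels by −μ p; since p is prime to n, this rotation has
-- order n / gcd(n , μ).

module Submission where

open import Defs
open import Data.Nat using (ℕ; zero; suc; _+_; _*_; _∸_; _≤_; _<_; _/_; _<ᵇ_; z≤n; s≤s; NonZero)
import Data.Nat as ℕ
import Data.Nat.Properties as ℕₚ
import Data.Nat.DivMod as ℕ
open import Data.Nat.Divisibility
  using (_∣_; divides; m%n≡0⇒n∣m; ∣m+n∣m⇒∣n; ∣⇒≤; *-cancelʳ-∣; n∣m*n; ∣m⇒∣m*n; ∣n⇒∣m*n)
open import Data.Nat.GCD using (gcd; gcd[m,n]∣m; gcd[m,n]∣n; gcd-greatest; c*gcd[m,n]≡gcd[cm,cn])
open import Data.Nat.ListAction using (sum)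
open import Data.Nat.Tactic.RingSolver using () renaming (solve-∀ to solve-∀ℕ)
open import Data.Integer using (ℤ; +_; -[1+_]; 0ℤ; 1ℤ; -1ℤ; ∣_∣)
  renaming (_+_ to _⊕_; _*_ to _⊗_; _-_ to _⊖_; -_ to ⊝_)
import Data.Integer.Properties as ℤₚ
open import Data.Integer.DivMod using (_%ℕ_; _/ℕ_; n%ℕd<d; a≡a%ℕn+[a/ℕn]*n)
open import Data.Integer.Tactic.RingSolver using (solve-∀)
open import Data.Fin using (Fin; toℕ)
import Data.Fin as Fin
import Data.Fin.Properties as Finₚ
open import Data.Fin.Permutation
  using (Permutation′; permutation; transpose; _⟨$⟩ʳ_; _⟨$⟩ˡ_; inverseˡ; inverseʳ)
open import Data.List using (applyUpTo; map; allFin; tabulate)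
import Data.List.Properties as Listₚ
open import Algebra.Properties.CommutativeMonoid.Sum ℕₚ.+-0-commutativeMonoid
  using (sum-permute) renaming (sum to sumᵥ)
open import Data.Bool using (Bool; true; false; if_then_else_; not; _∧_; _∨_; _xor_)
import Data.Bool.Properties as Boolₚ
open import Data.Empty using (⊥)
open import Data.Maybe using (just; nothing)
open import Data.Product using (_,_; _×_; ∃-syntax; proj₁; proj₂)
open import Data.Sum using (_⊎_; inj₁; inj₂; [_,_]′)
open import Function using (_∘_)
open import Function.Bundles using (Equivalence)
open import Relation.Nullary using (¬_; yes; no; contradiction)
open import Relation.Nullary.Decidable using (dec-true; dec-false)
open import Relation.Binary.Definitions using (tri<; tri≈; tri>)
open import Relation.Binary.PropositionalEquality

-- Congruences between integers

-- Two moduli act at once: labels live modulo n, the order of the vertices at rest modulo n - 1, and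
-- a vertex that is passed changes its label but not its place. What reconciles them is that the
-- distance from the carrier to a vertex at rest, a number between 1 and n - 1, is the same counted
-- in labels and in places. The position of the carrier is therefore kept as one integer, R β + ε r,
-- which gives its label modulo n (up to a unit depending on the direction) and its place modulo n -
-- 1. Modulo n - 1 this integer does not see which carriers went down; modulo n each of them
-- contributes -(n - 1) ≡ 1. That is the source of the rotation, which over p n takeovers is by p (n
-- - μ) ≡ -p μ. The given state lies inside a carry: v_n counts as having set out from the place of
-- v_{n-1}. The choice of direction, σ(v_1) < σ(v_{n-1}), ensures that it has not yet arrived at
-- v_1.

infix 4 _≡_[mod_]

data _≡_[mod_] (a b : ℤ) (m : ℕ) : Set where
  multiple : (k : ℤ) → a ≡ b ⊕ k ⊗ + m → a ≡ b [mod m ]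

mod-reflexive : ∀ {m a b} → a ≡ b → a ≡ b [mod m ]
mod-reflexive {m} {a} refl = multiple 0ℤ (eq a (+ m))
  where eq : ∀ a m → a ≡ a ⊕ 0ℤ ⊗ m
        eq = solve-∀

private
  transpose-multiple : ∀ {a b} k m → a ≡ b ⊕ k ⊗ m → b ≡ a ⊕ ⊝ k ⊗ m
  transpose-multiple {b = b} k m refl = eq b k m
    where eq : ∀ b k m → b ≡ b ⊕ k ⊗ m ⊕ ⊝ k ⊗ m
          eq = solve-∀

mod-sym : ∀ {m a b} → a ≡ b [mod m ] → b ≡ a [mod m ]
mod-sym {m} (multiple k eq) = multiple (⊝ k) (transpose-multiple k (+ m) eq)

mod-trans : ∀ {m a b c} → a ≡ b [mod m ] → b ≡ c [mod m ] → a ≡ c [mod m ]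
mod-trans {m} {c = c} (multiple k refl) (multiple l refl) = multiple (l ⊕ k) (eq c k l (+ m))
  where eq : ∀ c k l m → c ⊕ l ⊗ m ⊕ k ⊗ m ≡ c ⊕ (l ⊕ k) ⊗ m
        eq = solve-∀

mod-+ : ∀ {m a b c d} → a ≡ b [mod m ] → c ≡ d [mod m ] → a ⊕ c ≡ b ⊕ d [mod m ]
mod-+ {m} {b = b} {d = d} (multiple k refl) (multiple l refl) = multiple (k ⊕ l) (eq b d k l (+ m))
  where eq : ∀ b d k l m → (b ⊕ k ⊗ m) ⊕ (d ⊕ l ⊗ m) ≡ b ⊕ d ⊕ (k ⊕ l) ⊗ m
        eq = solve-∀

mod-*ˡ : ∀ {m a b} c → a ≡ b [mod m ] → c ⊗ a ≡ c ⊗ b [mod m ]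
mod-*ˡ {m} {b = b} c (multiple k refl) = multiple (c ⊗ k) (eq b c k (+ m))
  where eq : ∀ b c k m → c ⊗ (b ⊕ k ⊗ m) ≡ c ⊗ b ⊕ (c ⊗ k) ⊗ m
        eq = solve-∀

mod-+ʳ : ∀ {m a b} c → a ≡ b [mod m ] → a ⊕ c ≡ b ⊕ c [mod m ]
mod-+ʳ {a = a} {b} c p = mod-+ {a = a} {b} {c} {c} p (mod-reflexive refl)

mod-+ˡ : ∀ {m a b} c → a ≡ b [mod m ] → c ⊕ a ≡ c ⊕ b [mod m ]
mod-+ˡ {a = a} {b} c p = mod-+ {a = c} {c} {a} {b} (mod-reflexive refl) p

mod-- : ∀ {m a b c d} → a ≡ b [mod m ] → c ≡ d [mod m ] → a ⊖ c ≡ b ⊖ d [mod m ]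
mod-- {m} {b = b} {d = d} (multiple k refl) (multiple l refl) = multiple (k ⊖ l) (eq b d k l (+ m))
  where eq : ∀ b d k l m → (b ⊕ k ⊗ m) ⊖ (d ⊕ l ⊗ m) ≡ b ⊖ d ⊕ (k ⊖ l) ⊗ m
        eq = solve-∀

mod-cast : ∀ {m a a′ b b′} → a ≡ a′ → a′ ≡ b′ [mod m ] → b′ ≡ b → a ≡ b [mod m ]
mod-cast refl p refl = p

mod-∣ : ∀ {m a} → m ∣ a → + a ≡ 0ℤ [mod m ]
mod-∣ {m} (divides q refl) = multiple (+ q) (trans (ℤₚ.pos-* q m) (sym (ℤₚ.+-identityˡ _)))

∣-mod : ∀ {m a} → + a ≡ 0ℤ [mod m ] → m ∣ a
∣-mod {m} (multiple k eq) =
  divides ∣ k ∣ (trans (cong ∣_∣ (trans eq (ℤₚ.+-identityˡ (k ⊗ + m)))) (ℤₚ.abs-* k (+ m)))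

private
  mod-small-pos : ∀ {m a b} k → a < m → + a ≡ + b ⊕ + k ⊗ + m → a ≡ b
  mod-small-pos {m} {a} {b} k a<m eq = go k (ℤₚ.+-injective (trans eq (cong (+ b ⊕_) (sym (ℤₚ.pos-* k m)))))
    where
    go : ∀ k → a ≡ b + k * m → a ≡ b
    go zero    eq = trans eq (ℕₚ.+-identityʳ b)
    go (suc k) eq = contradiction a<m (ℕₚ.≤⇒≯ (subst (m ≤_) (sym eq)
      (ℕₚ.≤-trans (ℕₚ.m≤m+n m (k * m)) (ℕₚ.m≤n+m _ b))))

mod-small : ∀ {m a b} → a < m → b < m → + a ≡ + b [mod m ] → a ≡ b
mod-small a<m b<m (multiple (+ k) eq) = mod-small-pos k a<m eq
mod-small {m} a<m b<m (multiple k@(-[1+ l ]) eq) =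
  sym (mod-small-pos (suc l) b<m (transpose-multiple k (+ m) eq))

-- For places the representatives 1, ..., n - 1 are the right ones: a vertex just behind the carrier
-- is at distance n - 1, not 0.
mod-small⁺ : ∀ {m a b} → 1 ≤ a → a ≤ m → 1 ≤ b → b ≤ m → + a ≡ + b [mod m ] → a ≡ b
mod-small⁺ {a = suc a} {suc b} _ a≤m _ b≤m p = cong suc (mod-small a≤m b≤m
  (mod-cast (eq (+ a)) (mod-+ (mod-reflexive (refl {x = -1ℤ})) p) (sym (eq (+ b)))))
  where eq : ∀ a → a ≡ -1ℤ ⊕ (1ℤ ⊕ a)
        eq = solve-∀

⟦_⟧ : Sgn → ℤ
⟦ pos ⟧ = 1ℤ
⟦ neg ⟧ = -1ℤ

⟦⟧-cancel : ∀ ε {m a b} → ⟦ ε ⟧ ⊗ a ≡ ⟦ ε ⟧ ⊗ b [mod m ] → a ≡ b [mod m ]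
⟦⟧-cancel pos {a = a} {b} p = mod-cast (sym (ℤₚ.*-identityˡ a)) p (ℤₚ.*-identityˡ b)
⟦⟧-cancel neg {a = a} {b} p = mod-cast (eq a) (mod-*ˡ -1ℤ p) (sym (eq b))
  where eq : ∀ a → a ≡ -1ℤ ⊗ (-1ℤ ⊗ a)
        eq = solve-∀

mod-+-cancelˡ : ∀ {m a b} c → c ⊕ a ≡ c ⊕ b [mod m ] → a ≡ b [mod m ]
mod-+-cancelˡ {a = a} {b} c p = mod-cast (eq a c) (mod-+ (mod-reflexive (refl {x = ⊝ c})) p) (sym (eq b c))
  where eq : ∀ a c → a ≡ ⊝ c ⊕ (c ⊕ a)
        eq = solve-∀

mod-exchange : ∀ {m} a b c d → a ⊖ b ≡ c ⊖ d [mod m ] → a ⊖ c ≡ b ⊖ d [mod m ]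
mod-exchange a b c d p = mod-cast (eq a b c) (mod-+ʳ (b ⊖ c) p) (eq′ b c d)
  where eq : ∀ a b c → a ⊖ c ≡ a ⊖ b ⊕ (b ⊖ c)
        eq = solve-∀
        eq′ : ∀ b c d → c ⊖ d ⊕ (b ⊖ c) ≡ b ⊖ d
        eq′ = solve-∀

-- Positions on the cycle

toℤ : ∀ {n} → Fin n → ℤ
toℤ i = + toℕ i

toℤ-injective : ∀ {n} {i j : Fin n} → toℤ i ≡ toℤ j [mod n ] → i ≡ j
toℤ-injective {i = i} {j} p = Finₚ.toℕ-injective (mod-small (Finₚ.toℕ<n i) (Finₚ.toℕ<n j) p)

toℤ-sucMod : ∀ {n} (i : Fin n) → toℤ (sucMod i) ≡ toℤ i ⊕ 1ℤ [mod n ]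
toℤ-sucMod {suc n} i with toℕ i ℕ.<? n
... | yes p = mod-reflexive (cong +_ (trans (Finₚ.toℕ-fromℕ< (s≤s p)) (ℕₚ.+-comm 1 (toℕ i))))
... | no ¬p = multiple -1ℤ (subst (λ x → 0ℤ ≡ + x ⊕ 1ℤ ⊕ -1ℤ ⊗ + suc n) (sym i≡n) (eq (+ n)))
  where
  i≡n : toℕ i ≡ n
  i≡n = ℕₚ.≤-antisym (ℕₚ.≤-pred (Finₚ.toℕ<n i)) (ℕₚ.≮⇒≥ ¬p)
  eq : ∀ n → 0ℤ ≡ n ⊕ 1ℤ ⊕ -1ℤ ⊗ (1ℤ ⊕ n)
  eq = solve-∀

toℤ-predMod : ∀ {n} (i : Fin n) → toℤ (predMod i) ≡ toℤ i ⊕ -1ℤ [mod n ]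
toℤ-predMod {suc n} Fin.zero =
  multiple 1ℤ (subst (λ x → + x ≡ 0ℤ ⊕ -1ℤ ⊕ 1ℤ ⊗ + suc n) (sym (Finₚ.toℕ-fromℕ n)) (eq (+ n)))
  where eq : ∀ n → n ≡ 0ℤ ⊕ -1ℤ ⊕ 1ℤ ⊗ (1ℤ ⊕ n)
        eq = solve-∀
toℤ-predMod {suc n} (Fin.suc i) =
  mod-reflexive (trans (cong +_ (Finₚ.toℕ-inject₁ i)) (eq (+ toℕ i)))
  where eq : ∀ i → i ≡ 1ℤ ⊕ i ⊕ -1ℤ
        eq = solve-∀

toℤ-step : ∀ {n} ε (i : Fin n) → toℤ (step ε i) ≡ toℤ i ⊕ ⟦ ε ⟧ [mod n ]
toℤ-step pos = toℤ-sucMod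
toℤ-step neg = toℤ-predMod

sucMod-predMod : ∀ {n} (i : Fin n) → sucMod (predMod i) ≡ i
sucMod-predMod i = toℤ-injective (mod-trans (toℤ-sucMod _)
  (mod-cast refl (mod-+ (toℤ-predMod i) (mod-reflexive refl)) (eq (toℤ i))))
  where eq : ∀ i → i ⊕ -1ℤ ⊕ 1ℤ ≡ i
        eq = solve-∀

toℤ-steps : ∀ {n} ε k (i : Fin n) → toℤ (steps ε k i) ≡ toℤ i ⊕ ⟦ ε ⟧ ⊗ + k [mod n ]
toℤ-steps ε zero    i = mod-reflexive (eq (toℤ i) ⟦ ε ⟧)
  where eq : ∀ i e → i ≡ i ⊕ e ⊗ 0ℤ
        eq = solve-∀
toℤ-steps ε (suc k) i = mod-trans (toℤ-step ε _)
  (mod-cast refl (mod-+ (toℤ-steps ε k i) (mod-reflexive refl)) (eq (toℤ i) ⟦ ε ⟧ (+ k)))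
  where eq : ∀ i e k → i ⊕ e ⊗ k ⊕ e ≡ i ⊕ e ⊗ (1ℤ ⊕ k)
        eq = solve-∀

-- One step of Θ

transpose-left : ∀ {n} (i j : Fin n) → transpose i j ⟨$⟩ʳ i ≡ j
transpose-left i j rewrite dec-true (i Fin.≟ i) refl = refl

transpose-right : ∀ {n} (i j : Fin n) → transpose i j ⟨$⟩ʳ j ≡ i
transpose-right i j with j Fin.≟ i
... | yes refl = refl
... | no _ rewrite dec-true (j Fin.≟ j) refl = refl

transpose-other : ∀ {n} (i j k : Fin n) → k ≢ i → k ≢ j → transpose i j ⟨$⟩ʳ k ≡ k
transpose-other i j k k≢i k≢j rewrite dec-false (k Fin.≟ i) k≢i | dec-false (k Fin.≟ j) k≢j = refl

-- In the state (σ , i , ε) the vertex labelled own ε i is carried in direction ε, towards the vertex labelled ahead ε i.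
own ahead : ∀ {n} → Sgn → Fin n → Fin n
own pos i = i
own neg i = sucMod i
ahead pos i = sucMod i
ahead neg i = i

toℤ-ahead : ∀ {n} ε (i : Fin n) → toℤ (ahead ε i) ≡ toℤ (own ε i) ⊕ ⟦ ε ⟧ [mod n ]
toℤ-ahead pos i = toℤ-sucMod i
toℤ-ahead neg i = mod-sym (mod-cast refl (mod-+ʳ -1ℤ (toℤ-sucMod i)) (eq (toℤ i)))
  where eq : ∀ i → i ⊕ 1ℤ ⊕ -1ℤ ≡ i
        eq = solve-∀

-- Serves a jump, which puts the carrier on label `ahead ε i`, and a reflection, which leaves the
-- new carrier there.
own-step : ∀ {n} ε (i : Fin n) → own ε (step ε i) ≡ ahead ε i
own-step pos i = refl
own-step neg i = sucMod-predMod i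

-- A refraction swaps the neighbour into label `own ε i` and reverses the direction, so the new
-- carrier departs from where the old one stood.
own-turn : ∀ {n} ε (i : Fin n) → own (negate ε) (step (negate ε) i) ≡ own ε i
own-turn pos i = sucMod-predMod i
own-turn neg i = refl

module _ {n} (σ : Permutation′ n) (ε : Sgn) (i : Fin n) where

  sApply-own : ∀ {u} → σ ⟨$⟩ʳ u ≡ own ε i → sApply i σ ⟨$⟩ʳ u ≡ ahead ε i
  sApply-own eq = trans (cong (transpose i (sucMod i) ⟨$⟩ʳ_) eq) (go ε)
    where
    go : ∀ ε → transpose i (sucMod i) ⟨$⟩ʳ own ε i ≡ ahead ε i
    go pos = transpose-left i (sucMod i)
    go neg = transpose-right i (sucMod i)

  sApply-ahead : ∀ {u} → σ ⟨$⟩ʳ u ≡ ahead ε i → sApply i σ ⟨$⟩ʳ u ≡ own ε i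
  sApply-ahead eq = trans (cong (transpose i (sucMod i) ⟨$⟩ʳ_) eq) (go ε)
    where
    go : ∀ ε → transpose i (sucMod i) ⟨$⟩ʳ ahead ε i ≡ own ε i
    go pos = transpose-right i (sucMod i)
    go neg = transpose-left i (sucMod i)

  sApply-other : ∀ {u} → σ ⟨$⟩ʳ u ≢ own ε i → σ ⟨$⟩ʳ u ≢ ahead ε i → sApply i σ ⟨$⟩ʳ u ≡ σ ⟨$⟩ʳ u
  sApply-other {u} = go ε
    where
    go : ∀ ε → σ ⟨$⟩ʳ u ≢ own ε i → σ ⟨$⟩ʳ u ≢ ahead ε i → sApply i σ ⟨$⟩ʳ u ≡ σ ⟨$⟩ʳ u
    go pos ≢i ≢j = transpose-other i (sucMod i) _ ≢i ≢j
    go neg ≢j ≢i = transpose-other i (sucMod i) _ ≢i ≢j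

Adjacent : ∀ {n} → Fin n → Fin n → Set
Adjacent a b = b ≡ sucMod a ⊎ a ≡ sucMod b

Adjacent-sym : ∀ {n} {a b : Fin n} → Adjacent a b → Adjacent b a
Adjacent-sym (inj₁ p) = inj₂ p
Adjacent-sym (inj₂ p) = inj₁ p

module Step {n} (refr Y : Fin n → Bool) (refr-Y : ∀ k → refr k ≡ Y k xor Y (sucMod k)) where

  private
    xor-comm : ∀ a b → a xor b ≡ b xor a
    xor-comm true  true  = refl
    xor-comm true  false = refl
    xor-comm false true  = refl
    xor-comm false false = refl

  -- By `refr-Y` the kind of an edge depends only on the parts of its endpoints, so neither the
  -- orientation of the edge nor the direction of the carrier matters.
  edgeKind-adjacent : ∀ {a b} → Adjacent a b → edgeKind refr a b ≡ just (Y a xor Y b)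
  edgeKind-adjacent {a} {b} adj with b Fin.≟ sucMod a
  ... | yes refl = cong just (refr-Y a)
  ... | no ¬p with a Fin.≟ sucMod b
  ...   | yes refl = cong just (trans (refr-Y b) (xor-comm (Y b) (Y (sucMod b))))
  ...   | no ¬q = contradiction adj [ ¬p , ¬q ]′

  edgeKind-nonadjacent : ∀ {a b} → ¬ Adjacent a b → edgeKind refr a b ≡ nothing
  edgeKind-nonadjacent {a} {b} ¬adj with b Fin.≟ sucMod a
  ... | yes p = contradiction (inj₁ p) ¬adj
  ... | no _ with a Fin.≟ sucMod b
  ...   | yes p = contradiction (inj₂ p) ¬adj
  ...   | no _ = refl

  module _ {σ : Permutation′ n} {i : Fin n} {ε : Sgn} {c w : Fin n}
           (σc : σ ⟨$⟩ʳ c ≡ own ε i) (σw : σ ⟨$⟩ʳ w ≡ ahead ε i) where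

    private
      from≡ : ∀ {u j} → σ ⟨$⟩ʳ u ≡ j → σ ⟨$⟩ˡ j ≡ u
      from≡ refl = inverseˡ σ

      kind : ∀ ε → σ ⟨$⟩ʳ c ≡ own ε i → σ ⟨$⟩ʳ w ≡ ahead ε i → ∀ {k} →
             edgeKind refr c w ≡ k → edgeKind refr w c ≡ k →
             edgeKind refr (σ ⟨$⟩ˡ i) (σ ⟨$⟩ˡ sucMod i) ≡ k
      kind pos p q k₁ k₂ rewrite from≡ p | from≡ q = k₁
      kind neg p q k₁ k₂ rewrite from≡ p | from≡ q = k₂

      Θ-kind : ∀ {k} → edgeKind refr c w ≡ k → edgeKind refr w c ≡ k →
               edgeKind refr (σ ⟨$⟩ˡ i) (σ ⟨$⟩ˡ sucMod i) ≡ k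
      Θ-kind = kind ε σc σw

    Θ-jump : ¬ Adjacent c w → Θ refr (σ , i , ε) ≡ (sApply i σ , step ε i , ε)
    Θ-jump ¬adj rewrite Θ-kind (edgeKind-nonadjacent ¬adj) (edgeKind-nonadjacent (¬adj ∘ Adjacent-sym)) = refl

    private
      Θ-meet : Adjacent c w → edgeKind refr (σ ⟨$⟩ˡ i) (σ ⟨$⟩ˡ sucMod i) ≡ just (Y c xor Y w)
      Θ-meet adj = Θ-kind (edgeKind-adjacent adj)
        (trans (edgeKind-adjacent (Adjacent-sym adj)) (cong just (xor-comm (Y w) (Y c))))

    Θ-reflect : Adjacent c w → Y c xor Y w ≡ false → Θ refr (σ , i , ε) ≡ (σ , step ε i , ε)
    Θ-reflect adj same rewrite Θ-meet adj | same = refl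

    Θ-refract : Adjacent c w → Y c xor Y w ≡ true →
                Θ refr (σ , i , ε) ≡ (sApply i σ , step (negate ε) i , negate ε)
    Θ-refract adj diff rewrite Θ-meet adj | diff = refl

signOf : Bool → Sgn
signOf true = pos
signOf false = neg

signOf-same : ∀ a b → a xor b ≡ false → signOf b ≡ signOf a
signOf-same true true _ = refl
signOf-same false false _ = refl

signOf-diff : ∀ a b → a xor b ≡ true → signOf b ≡ negate (signOf a)
signOf-diff true false _ = refl
signOf-diff false true _ = refl

-- Measured from the same spot, a carrier moving down is one label below a carrier moving up.
lag : Sgn → ℤ
lag pos = 0ℤ
lag neg = -1ℤ

⟦negate⟧ : ∀ ε → ⟦ negate ε ⟧ ≡ ⊝ ⟦ ε ⟧
⟦negate⟧ pos = refl
⟦negate⟧ neg = refl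

lag-negate : ∀ ε → lag (negate ε) ≡ lag ε ⊖ ⟦ ε ⟧
lag-negate pos = refl
lag-negate neg = refl

-- Walks around the cycle graph

module Walk {n′ : ℕ} (v : ℕ → Fin (suc n′)) (d : Sgn) (v-suc : ∀ β → v (suc β) ≡ step d (v β)) where

  private n = suc n′

  v-+ : ∀ β j → v (β + j) ≡ steps d j (v β)
  v-+ β zero = cong v (ℕₚ.+-identityʳ β)
  v-+ β (suc j) = trans (cong v (ℕₚ.+-suc β j)) (trans (v-suc (β + j)) (cong (step d) (v-+ β j)))

  toℤ-v : ∀ β j → toℤ (v (β + j)) ≡ toℤ (v β) ⊕ ⟦ d ⟧ ⊗ + j [mod n ]
  toℤ-v β j = subst (λ u → toℤ u ≡ toℤ (v β) ⊕ ⟦ d ⟧ ⊗ + j [mod n ]) (sym (v-+ β j)) (toℤ-steps d j (v β))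

  v-periodic : ∀ β → v (β + n) ≡ v β
  v-periodic β = toℤ-injective (mod-trans (toℤ-v β n) (multiple ⟦ d ⟧ refl))

  v-≡⇒∣ : ∀ β j → v (β + j) ≡ v β → n ∣ j
  v-≡⇒∣ β j eq = ∣-mod (⟦⟧-cancel d (mod-+-cancelˡ (toℤ (v β))
    (mod-trans (mod-sym (toℤ-v β j)) (mod-reflexive (trans (cong toℤ eq) (unit (toℤ (v β)) ⟦ d ⟧))))))
    where unit : ∀ x e → x ≡ x ⊕ e ⊗ 0ℤ
          unit = solve-∀

  v-injective : ∀ β j k → j < n → k < n → v (β + j) ≡ v (β + k) → j ≡ k
  v-injective β j k j<n k<n eq = mod-small j<n k<n (⟦⟧-cancel d (mod-+-cancelˡ (toℤ (v β))
    (mod-trans (mod-sym (toℤ-v β j)) (subst (λ u → toℤ u ≡ toℤ (v β) ⊕ ⟦ d ⟧ ⊗ + k [mod n ]) (sym eq) (toℤ-v β k)))))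

  -- Solves u = v β + d j for j modulo n, with d as its own inverse.
  v-surjective : ∀ β u → ∃[ j ] j < n × v (β + j) ≡ u
  v-surjective β u = z %ℕ n , n%ℕd<d z n , toℤ-injective
    (mod-trans (toℤ-v β (z %ℕ n)) (mod-trans (mod-+ˡ (toℤ (v β)) (mod-*ˡ ⟦ d ⟧ (mod-sym z%n)))
      (mod-reflexive (square d (toℤ u) (toℤ (v β))))))
    where
    z : ℤ
    z = ⟦ d ⟧ ⊗ (toℤ u ⊖ toℤ (v β))
    z%n : z ≡ + (z %ℕ n) [mod n ]
    z%n = multiple (z /ℕ n) (a≡a%ℕn+[a/ℕn]*n z n)
    square : ∀ d u a → a ⊕ ⟦ d ⟧ ⊗ (⟦ d ⟧ ⊗ (u ⊖ a)) ≡ u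
    square pos = eq
      where eq : ∀ u a → a ⊕ 1ℤ ⊗ (1ℤ ⊗ (u ⊖ a)) ≡ u
            eq = solve-∀
    square neg = eq
      where eq : ∀ u a → a ⊕ -1ℤ ⊗ (-1ℤ ⊗ (u ⊖ a)) ≡ u
            eq = solve-∀

  adjacent-next : ∀ β → Adjacent (v β) (v (suc β))
  adjacent-next β = subst (Adjacent (v β)) (sym (v-suc β)) (go d)
    where
    go : ∀ d → Adjacent (v β) (step d (v β))
    go pos = inj₁ refl
    go neg = inj₂ (sym (sucMod-predMod (v β)))

  -- Adjacency means d j ≡ ±1 modulo n, and n - 1 is the representative of -1.
  adjacent-only : 2 ≤ n′ → ∀ β j → j ≤ n′ → Adjacent (v β) (v (β + j)) → j ≡ 1 ⊎ j ≡ n′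
  adjacent-only 2≤n′ β j j≤n′ = [ go d pos ∘ displacement pos ∘ up , go d neg ∘ displacement neg ∘ down ]′
    where
    up : v (β + j) ≡ sucMod (v β) → toℤ (v (β + j)) ≡ toℤ (v β) ⊕ 1ℤ [mod n ]
    up eq = subst (λ u → toℤ u ≡ toℤ (v β) ⊕ 1ℤ [mod n ]) (sym eq) (toℤ-sucMod (v β))
    down : v β ≡ sucMod (v (β + j)) → toℤ (v (β + j)) ≡ toℤ (v β) ⊕ -1ℤ [mod n ]
    down eq = mod-cast (cancel (toℤ (v (β + j)))) (mod-+ʳ -1ℤ (mod-sym (subst (λ u → toℤ u ≡ toℤ (v (β + j)) ⊕ 1ℤ [mod n ])
      (sym eq) (toℤ-sucMod (v (β + j)))))) refl
      where cancel : ∀ x → x ≡ x ⊕ 1ℤ ⊕ -1ℤ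
            cancel = solve-∀
    displacement : ∀ e → toℤ (v (β + j)) ≡ toℤ (v β) ⊕ ⟦ e ⟧ [mod n ] → ⟦ d ⟧ ⊗ + j ≡ ⟦ e ⟧ [mod n ]
    displacement e p = mod-+-cancelˡ (toℤ (v β)) (mod-trans (mod-sym (toℤ-v β j)) p)
    forward : + j ≡ 1ℤ [mod n ] → j ≡ 1
    forward = mod-small (s≤s j≤n′) (s≤s (ℕₚ.≤-trans (s≤s z≤n) 2≤n′))
    backward : + j ≡ + n′ [mod n ] → j ≡ n′
    backward = mod-small (s≤s j≤n′) ℕₚ.≤-refl
    go : ∀ d e → ⟦ d ⟧ ⊗ + j ≡ ⟦ e ⟧ [mod n ] → j ≡ 1 ⊎ j ≡ n′
    go pos pos p = inj₁ (forward (⟦⟧-cancel pos p))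
    go neg neg p = inj₁ (forward (⟦⟧-cancel neg p))
    go pos neg p = inj₂ (backward (⟦⟧-cancel pos (mod-trans p (multiple -1ℤ (eq (+ n′))))))
      where eq : ∀ m → -1ℤ ≡ 1ℤ ⊗ m ⊕ -1ℤ ⊗ (1ℤ ⊕ m)
            eq = solve-∀
    go neg pos p = inj₂ (backward (⟦⟧-cancel neg (mod-trans p (multiple 1ℤ (eq (+ n′))))))
      where eq : ∀ m → 1ℤ ≡ -1ℤ ⊗ m ⊕ 1ℤ ⊗ (1ℤ ⊕ m)
            eq = solve-∀

-- Trajectories of Θ

module Trajectory {n′ : ℕ} (2≤n′ : 2 ≤ n′)
  (refr Y : Fin (suc n′) → Bool) (refr-Y : ∀ k → refr k ≡ Y k xor Y (sucMod k))
  (v : ℕ → Fin (suc n′)) (d : Sgn) (v-suc : ∀ β → v (suc β) ≡ step d (v β))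
  -- `Q` has period n - 1 whereas `v` has period n. This is how a vertex changes its place: after
  -- its carry, `v β` rests as `v (β + n)` at `Q (β + n)`, which is `Q (suc β)`, the place of the
  -- vertex that it met.
  (Q R : ℕ → ℤ) (len : ℕ → ℕ)
  (Q-periodic : ∀ β → Q (β + n′) ≡ Q β)
  (R-Q : ∀ β → R β ≡ Q β [mod n′ ])
  (R-suc : ∀ β → R (suc β) ≡ R β ⊕ ⟦ signOf (Y (v β)) ⟧ ⊗ + len β)
  (len>0 : ∀ β → 1 ≤ len β) (len<n′ : ∀ β → len β < n′)
  where

  open Step refr Y refr-Y
  open Walk v d v-suc

  private
    n : ℕ
    n = suc n′

  sgn : ℕ → Sgn
  sgn β = signOf (Y (v β))

  X : ℕ → ℕ → ℤ
  X β r = R β ⊕ ⟦ sgn β ⟧ ⊗ + r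

  -- v_k lies distance labels ahead of the carrier in ℤ/n, and equally many places ahead of x in the
  -- cyclic order ℤ/(n − 1) of the vertices at rest, where it occupies the place Q k.
  record Spot (σ : Permutation′ n) (i : Fin n) (ε : Sgn) (x : ℤ) (k : ℕ) : Set where
    constructor spot
    field
      distance   : ℕ
      distance≥1 : 1 ≤ distance
      distance≤  : distance ≤ n′
      label      : toℤ (σ ⟨$⟩ʳ v k) ≡ toℤ (own ε i) ⊕ ⟦ ε ⟧ ⊗ + distance [mod n ]
      place      : Q k ≡ x ⊕ ⟦ ε ⟧ ⊗ + distance [mod n′ ]

  -- After r steps of the β-th carrier.
  record State (β r : ℕ) (σ : Permutation′ n) (i : Fin n) (ε : Sgn) : Set where
    constructor state
    field
      direction : ε ≡ sgn β
      carrier   : σ ⟨$⟩ʳ v β ≡ own ε i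
      position  : toℤ (own ε i) ≡ X β r ⊕ lag ε [mod n ]
      others    : ∀ j → 1 ≤ j → j ≤ n′ → Spot σ i ε (X β r) (β + j)

  StateOf : ℕ → ℕ → Ξ n → Set
  StateOf β r (σ , i , ε) = State β r σ i ε

  module _ {σ i ε x k} (s : Spot σ i ε x k) where
    open Spot s

    ahead⇒1 : σ ⟨$⟩ʳ v k ≡ ahead ε i → distance ≡ 1
    ahead⇒1 eq = mod-small (s≤s distance≤) (s≤s (ℕₚ.≤-trans (s≤s z≤n) 2≤n′)) (⟦⟧-cancel ε
      (mod-+-cancelˡ (toℤ (own ε i)) (mod-trans (mod-sym label) (mod-trans (mod-reflexive (cong toℤ eq))
        (mod-cast refl (toℤ-ahead ε i) (unit (toℤ (own ε i)) ⟦ ε ⟧))))))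
      where unit : ∀ z e → z ⊕ e ≡ z ⊕ e ⊗ 1ℤ
            unit = solve-∀

    1⇒ahead : distance ≡ 1 → σ ⟨$⟩ʳ v k ≡ ahead ε i
    1⇒ahead eq = toℤ-injective (mod-trans label
      (mod-cast (cong (λ E → toℤ (own ε i) ⊕ ⟦ ε ⟧ ⊗ + E) eq)
        (mod-sym (mod-cast refl (toℤ-ahead ε i) (unit (toℤ (own ε i)) ⟦ ε ⟧))) refl))
      where unit : ∀ z e → z ⊕ e ≡ z ⊕ e ⊗ 1ℤ
            unit = solve-∀

    not-own : σ ⟨$⟩ʳ v k ≢ own ε i
    not-own eq = ℕₚ.<⇒≢ distance≥1 (sym (mod-small (s≤s distance≤) (s≤s z≤n) (⟦⟧-cancel ε
      (mod-+-cancelˡ (toℤ (own ε i)) (mod-trans (mod-sym label) (mod-cast (cong toℤ eq)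
        (mod-reflexive refl) (unit (toℤ (own ε i)) ⟦ ε ⟧)))))))
      where unit : ∀ z e → z ≡ z ⊕ e ⊗ 0ℤ
            unit = solve-∀

  private
    split-≥1 : ∀ {E} → 1 ≤ E → E ≢ 1 → ∃[ E₀ ] E ≡ suc E₀ × 1 ≤ E₀
    split-≥1 {suc zero}    _ ≢1 = contradiction refl ≢1
    split-≥1 {suc (suc E)} _ _  = suc E , refl , s≤s z≤n

    n′≥1 : 1 ≤ n′
    n′≥1 = ℕₚ.≤-trans (s≤s z≤n) 2≤n′

  module _ {σ σ′ : Permutation′ n} {i i′ : Fin n} {ε : Sgn} {x : ℤ} {k : ℕ} where

    private
      z = toℤ (own ε i)
      e = ⟦ ε ⟧

    module _ (moved : own ε i′ ≡ ahead ε i) where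

      private
        z′ : toℤ (own ε i′) ≡ z ⊕ e [mod n ]
        z′ = subst (λ u → toℤ u ≡ z ⊕ e [mod n ]) (sym moved) (toℤ-ahead ε i)

      approach : (s : Spot σ i ε x k) → Spot.distance s ≢ 1 → σ′ ⟨$⟩ʳ v k ≡ σ ⟨$⟩ʳ v k →
                 Spot σ′ i′ ε (x ⊕ e) k
      approach (spot E E≥1 E≤n′ lab pl) E≢1 σ≡ with split-≥1 E≥1 E≢1
      ... | E₀ , refl , E₀≥1 = spot E₀ E₀≥1 (ℕₚ.≤-trans (ℕₚ.n≤1+n E₀) E≤n′)
        (mod-cast (cong toℤ σ≡) (mod-trans lab (mod-cast (eq z e (+ E₀)) (mod-+ʳ (e ⊗ + E₀) (mod-sym z′)) refl)) refl)
        (mod-cast refl pl (eq x e (+ E₀)))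
        where eq : ∀ z e E → z ⊕ e ⊗ (1ℤ ⊕ E) ≡ z ⊕ e ⊕ e ⊗ E
              eq = solve-∀

      -- Label `own ε i` is now one behind the carrier, hence n - 1 ahead of it modulo n; the place
      -- is that of the carrier itself, and n - 1 ≡ 0 there. This applies to a vertex just jumped
      -- over and to the old carrier after a reflection.
      park : σ′ ⟨$⟩ʳ v k ≡ own ε i → Q k ≡ x ⊕ e [mod n′ ] → Spot σ′ i′ ε (x ⊕ e) k
      park σ≡ pl = spot n′ n′≥1 ℕₚ.≤-refl
        (mod-cast (cong toℤ σ≡) (mod-trans (multiple (⊝ e) (eq z e (+ n′))) (mod-+ʳ (e ⊗ + n′) (mod-sym z′))) refl)
        (mod-trans pl (multiple (⊝ e) (eq′ (x ⊕ e) e (+ n′))))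
        where eq : ∀ z e m → z ≡ z ⊕ e ⊕ e ⊗ m ⊕ ⊝ e ⊗ (1ℤ ⊕ m)
              eq = solve-∀
              eq′ : ∀ x e m → x ≡ x ⊕ e ⊗ m ⊕ ⊝ e ⊗ m
              eq′ = solve-∀

    module _ (turned : own (negate ε) i′ ≡ own ε i) where

      private
        toTurned : ∀ {a E} → a ≡ z ⊕ ⊝ e ⊗ + E [mod n ] →
                   a ≡ toℤ (own (negate ε) i′) ⊕ ⟦ negate ε ⟧ ⊗ + E [mod n ]
        toTurned p rewrite turned | ⟦negate⟧ ε = p

        toTurned′ : ∀ {a E} → a ≡ x ⊕ e ⊕ ⊝ e ⊗ + E [mod n′ ] →
                    a ≡ x ⊕ e ⊕ ⟦ negate ε ⟧ ⊗ + E [mod n′ ]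
        toTurned′ p rewrite ⟦negate⟧ ε = p

      -- Seen in the other direction, distance E in labels becomes n - E. In places it becomes (n -
      -- 1) - (E - 1), the same number, because x advances by one while the label of the carrier
      -- does not.
      turn : Spot σ i ε x k → σ′ ⟨$⟩ʳ v k ≡ σ ⟨$⟩ʳ v k → Spot σ′ i′ (negate ε) (x ⊕ e) k
      turn (spot (suc E₀) _ E≤n′ lab pl) σ≡ = spot E′ (ℕₚ.m<n⇒0<n∸m E≤n′) (ℕₚ.m∸n≤m n′ E₀)
        (toTurned (mod-cast (cong toℤ σ≡) (mod-trans lab (multiple e
          (subst (λ m → z ⊕ e ⊗ + suc E₀ ≡ z ⊕ ⊝ e ⊗ + E′ ⊕ e ⊗ + suc m) sum≡ (eq z e (+ E₀) (+ E′))))) refl))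
        (toTurned′ (mod-trans pl (multiple e
          (subst (λ m → x ⊕ e ⊗ + suc E₀ ≡ x ⊕ e ⊕ ⊝ e ⊗ + E′ ⊕ e ⊗ + m) sum≡ (eq′ x e (+ E₀) (+ E′))))))
        where
        E′ = n′ ∸ E₀
        sum≡ : E₀ + E′ ≡ n′
        sum≡ = ℕₚ.m+[n∸m]≡n (ℕₚ.≤-trans (ℕₚ.n≤1+n E₀) E≤n′)
        eq : ∀ z e E E′ → z ⊕ e ⊗ (1ℤ ⊕ E) ≡ z ⊕ ⊝ e ⊗ E′ ⊕ e ⊗ (1ℤ ⊕ (E ⊕ E′))
        eq = solve-∀
        eq′ : ∀ x e E E′ → x ⊕ e ⊗ (1ℤ ⊕ E) ≡ x ⊕ e ⊕ ⊝ e ⊗ E′ ⊕ e ⊗ (E ⊕ E′)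
        eq′ = solve-∀

      -- For the old carrier after a refraction: it was swapped into `ahead ε i`, which is one
      -- behind a carrier moving the other way.
      turn-park : σ′ ⟨$⟩ʳ v k ≡ ahead ε i → Q k ≡ x ⊕ e [mod n′ ] → Spot σ′ i′ (negate ε) (x ⊕ e) k
      turn-park σ≡ pl = spot n′ n′≥1 ℕₚ.≤-refl
        (toTurned (mod-cast (cong toℤ σ≡) (mod-trans (toℤ-ahead ε i) (multiple e (eq z e (+ n′)))) refl))
        (toTurned′ (mod-trans pl (multiple e (eq′ (x ⊕ e) e (+ n′)))))
        where eq : ∀ z e m → z ⊕ e ≡ z ⊕ ⊝ e ⊗ m ⊕ e ⊗ (1ℤ ⊕ m)
              eq = solve-∀
              eq′ : ∀ x e m → x ≡ x ⊕ ⊝ e ⊗ m ⊕ e ⊗ m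
              eq′ = solve-∀

  private
    R-suc-X : ∀ β r → suc r ≡ len β → R (suc β) ≡ X β r ⊕ ⟦ sgn β ⟧
    R-suc-X β r eq = trans (R-suc β) (trans (cong (λ l → R β ⊕ ⟦ sgn β ⟧ ⊗ + l) (sym eq))
      (ring (R β) ⟦ sgn β ⟧ (+ r)))
      where ring : ∀ R e r → R ⊕ e ⊗ (1ℤ ⊕ r) ≡ R ⊕ e ⊗ r ⊕ e
            ring = solve-∀

    X-suc : ∀ β r → X β (suc r) ≡ X β r ⊕ ⟦ sgn β ⟧
    X-suc β r = ring (R β) ⟦ sgn β ⟧ (+ r)
      where ring : ∀ R e r → R ⊕ e ⊗ (1ℤ ⊕ r) ≡ R ⊕ e ⊗ r ⊕ e
            ring = solve-∀

    X-0 : ∀ β → X β 0 ≡ R β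
    X-0 β = sym (ring (R β) ⟦ sgn β ⟧)
      where ring : ∀ R e → R ≡ R ⊕ e ⊗ 0ℤ
            ring = solve-∀

    Q-suc : ∀ β r → suc r ≡ len β → Q (suc β) ≡ X β r ⊕ ⟦ sgn β ⟧ [mod n′ ]
    Q-suc β r eq = mod-cast refl (mod-sym (R-Q (suc β))) (R-suc-X β r eq)

  module Advance {β r σ i} (s : State β r σ i (sgn β)) where
    open State s
    private
      ε = sgn β
      σ⁺ = sApply i σ
      w = σ ⟨$⟩ˡ ahead ε i

      σw : σ ⟨$⟩ʳ w ≡ ahead ε i
      σw = inverseʳ σ

      ahead-place : ∀ j → 1 ≤ j → j ≤ n′ → σ ⟨$⟩ʳ v (β + j) ≡ ahead ε i → Q (β + j) ≡ R β ⊕ ⟦ ε ⟧ ⊗ + suc r [mod n′ ]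
      ahead-place j 1≤j j≤n′ eq = mod-cast refl (Spot.place sp)
        (trans (cong (λ E → X β r ⊕ ⟦ ε ⟧ ⊗ + E) (ahead⇒1 sp eq)) (ring (R β) ⟦ ε ⟧ (+ r)))
        where sp = others j 1≤j j≤n′
              ring : ∀ R e r → R ⊕ e ⊗ r ⊕ e ⊗ 1ℤ ≡ R ⊕ e ⊗ (1ℤ ⊕ r)
              ring = solve-∀

    jump : suc r < len β → StateOf β (suc r) (Θ refr (σ , i , ε))
    jump r<len = subst (StateOf β (suc r)) (sym (Θ-jump {σ = σ} carrier σw ¬adj)) (state refl
        (trans (sApply-own σ ε i carrier) (sym (own-step ε i)))
        (mod-cast (cong toℤ (own-step ε i)) (mod-trans (toℤ-ahead ε i) (mod-+ʳ ⟦ ε ⟧ position))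
          (trans (ring (X β r) (lag ε) ⟦ ε ⟧) (cong (_⊕ lag ε) (sym (X-suc β r)))))
        λ j 1≤j j≤n′ → subst (λ x → Spot σ⁺ (step ε i) ε x (β + j)) (sym (X-suc β r)) (move j 1≤j j≤n′))
      where
      ring : ∀ x l e → x ⊕ l ⊕ e ≡ x ⊕ e ⊕ l
      ring = solve-∀
      r<n′ : suc r < n′
      r<n′ = ℕₚ.<-trans r<len (len<n′ β)
      ¬adj : ¬ Adjacent (v β) w
      ¬adj adj with v-surjective β w
      ... | j , j<n , vj≡w with adjacent-only 2≤n′ β j (ℕₚ.≤-pred j<n) (subst (Adjacent (v β)) (sym vj≡w) adj)
      -- The next vertex rests `len β` places beyond `R β`, the place just ahead only `suc r`.
      ... | inj₁ refl = contradiction (mod-small r<n′ (len<n′ β) (⟦⟧-cancel ε (mod-+-cancelˡ (R β)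
              (mod-trans (mod-sym (ahead-place 1 (s≤s z≤n) n′≥1 (trans (cong (σ ⟨$⟩ʳ_) vj≡w) σw)))
                (mod-cast (cong Q (ℕₚ.+-comm β 1)) (mod-sym (R-Q (suc β))) (R-suc β))))))
              (ℕₚ.<⇒≢ r<len)
      -- The previous carrier rests at the place from which this one set out, and `suc r` is less
      -- than a full turn of n - 1 places.
      ... | inj₂ refl = contradiction (mod-small r<n′ (ℕₚ.<-trans (s≤s z≤n) r<n′) (⟦⟧-cancel ε (mod-+-cancelˡ (R β)
              (mod-trans (mod-sym (ahead-place n′ n′≥1 ℕₚ.≤-refl (trans (cong (σ ⟨$⟩ʳ_) vj≡w) σw)))
                (mod-cast (Q-periodic β) (mod-sym (R-Q β)) (sym (X-0 β)))))))
              λ ()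
      move : ∀ j → 1 ≤ j → j ≤ n′ → Spot σ⁺ (step ε i) ε (X β r ⊕ ⟦ ε ⟧) (β + j)
      move j 1≤j j≤n′ with others j 1≤j j≤n′
      ... | sp with Spot.distance sp ℕ.≟ 1
      ... | yes E≡1 = park {σ = σ} {x = X β r} (own-step ε i) (sApply-ahead σ ε i (1⇒ahead sp E≡1))
                        (mod-cast refl (Spot.place sp) (trans (cong (λ E → X β r ⊕ ⟦ ε ⟧ ⊗ + E) E≡1) (unit (X β r) ⟦ ε ⟧)))
        where unit : ∀ x e → x ⊕ e ⊗ 1ℤ ≡ x ⊕ e
              unit = solve-∀
      ... | no E≢1 = approach (own-step ε i) sp E≢1 (sApply-other σ ε i (not-own sp) (E≢1 ∘ ahead⇒1 sp))

    meet : suc r ≡ len β → StateOf (suc β) 0 (Θ refr (σ , i , ε))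
    meet r≡len = go (Y (v β) xor Y (v (suc β))) refl
      where
      σv : σ ⟨$⟩ʳ v (suc β) ≡ ahead ε i
      σv = trans (cong (σ ⟨$⟩ʳ_) (cong v (ℕₚ.+-comm 1 β))) (1⇒ahead sp (mod-small⁺ (Spot.distance≥1 sp) (Spot.distance≤ sp) (s≤s z≤n) n′≥1
        (⟦⟧-cancel ε (mod-+-cancelˡ (X β r) (mod-trans (mod-sym (Spot.place sp))
          (mod-cast (cong Q (ℕₚ.+-comm β 1)) (Q-suc β r r≡len) (unit (X β r) ⟦ ε ⟧)))))))
        where sp = others 1 (s≤s z≤n) n′≥1
              unit : ∀ x e → x ⊕ e ≡ x ⊕ e ⊗ 1ℤ
              unit = solve-∀
      X≡ : X (suc β) 0 ≡ X β r ⊕ ⟦ ε ⟧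
      X≡ = trans (X-0 (suc β)) (R-suc-X β r r≡len)
      -- Counted from the new carrier, the vertices at rest move down by one index, and the old
      -- carrier becomes the last of them, at the place that the new carrier leaves.
      last-vertex : v (suc β + n′) ≡ v β
      last-vertex = trans (cong v (sym (ℕₚ.+-suc β n′))) (v-periodic β)
      last-place : Q (suc β + n′) ≡ X β r ⊕ ⟦ ε ⟧ [mod n′ ]
      last-place = mod-cast (Q-periodic (suc β)) (Q-suc β r r≡len) refl
      not-ahead : ∀ {j} (1≤j : 1 ≤ j) (j<n′ : j < n′) → σ ⟨$⟩ʳ v (β + suc j) ≢ ahead ε i
      not-ahead {j} 1≤j j<n′ eq = ℕₚ.<⇒≢ (s≤s 1≤j) (sym (v-injective β (suc j) 1 (s≤s j<n′) (s≤s n′≥1)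
        (trans (sym (inverseˡ σ)) (trans (cong (σ ⟨$⟩ˡ_) (trans eq (trans (sym σv) (cong (λ k → σ ⟨$⟩ʳ v k) (ℕₚ.+-comm 1 β))))) (inverseˡ σ)))))
      go : ∀ b → Y (v β) xor Y (v (suc β)) ≡ b → StateOf (suc β) 0 (Θ refr (σ , i , ε))
      go false same = subst (StateOf (suc β) 0) (sym (Θ-reflect {σ = σ} carrier σv (adjacent-next β) same))
        (state (sym (signOf-same (Y (v β)) (Y (v (suc β))) same))
          (trans σv (sym (own-step ε i)))
          (mod-cast (cong toℤ (own-step ε i)) (mod-trans (toℤ-ahead ε i) (mod-+ʳ ⟦ ε ⟧ position))
            (trans (ring (X β r) (lag ε) ⟦ ε ⟧) (cong (_⊕ lag ε) (sym X≡))))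
          λ j 1≤j j≤n′ → subst (λ x → Spot σ (step ε i) ε x (suc β + j)) (sym X≡) (move j 1≤j (ℕₚ.m≤n⇒m<n∨m≡n j≤n′)))
        where
        ring : ∀ x l e → x ⊕ l ⊕ e ≡ x ⊕ e ⊕ l
        ring = solve-∀
        move : ∀ j → 1 ≤ j → j < n′ ⊎ j ≡ n′ → Spot σ (step ε i) ε (X β r ⊕ ⟦ ε ⟧) (suc β + j)
        move j 1≤j (inj₂ refl) = park {σ = σ} {x = X β r} (own-step ε i) (trans (cong (σ ⟨$⟩ʳ_) last-vertex) carrier) last-place
        move j 1≤j (inj₁ j<n′) = subst (Spot σ (step ε i) ε (X β r ⊕ ⟦ ε ⟧)) (ℕₚ.+-suc β j)
          (approach (own-step ε i) sp (not-ahead 1≤j j<n′ ∘ 1⇒ahead sp) refl)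
          where sp = others (suc j) (s≤s z≤n) j<n′
      go true diff = subst (StateOf (suc β) 0) (sym (Θ-refract {σ = σ} carrier σv (adjacent-next β) diff))
        (state (sym (signOf-diff (Y (v β)) (Y (v (suc β))) diff))
          (trans (sApply-ahead σ ε i σv) (sym (own-turn ε i)))
          -- X advances although the carried label stays the same; the change of `lag` makes up for
          -- it.
          (mod-cast (cong toℤ (own-turn ε i)) position
            (trans (ring (X β r) (lag ε) ⟦ ε ⟧) (sym (cong₂ _⊕_ X≡ (lag-negate ε)))))
          λ j 1≤j j≤n′ → subst (λ x → Spot σ⁺ i⁺ (negate ε) x (suc β + j)) (sym X≡) (move j 1≤j (ℕₚ.m≤n⇒m<n∨m≡n j≤n′)))
        where
        i⁺ = step (negate ε) i
        ring : ∀ x l e → x ⊕ l ≡ x ⊕ e ⊕ (l ⊖ e)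
        ring = solve-∀
        move : ∀ j → 1 ≤ j → j < n′ ⊎ j ≡ n′ → Spot σ⁺ i⁺ (negate ε) (X β r ⊕ ⟦ ε ⟧) (suc β + j)
        move j 1≤j (inj₂ refl) = turn-park {σ = σ} {x = X β r} (own-turn ε i)
          (sApply-own σ ε i (trans (cong (σ ⟨$⟩ʳ_) last-vertex) carrier)) last-place
        move j 1≤j (inj₁ j<n′) = subst (Spot σ⁺ i⁺ (negate ε) (X β r ⊕ ⟦ ε ⟧)) (ℕₚ.+-suc β j)
          (turn (own-turn ε i) sp (sApply-other σ ε i (not-own sp) (not-ahead 1≤j j<n′)))
          where sp = others (suc j) (s≤s z≤n) j<n′

  advance : ∀ {β r} ξ → r < len β → StateOf β r ξ →
            (suc r < len β × StateOf β (suc r) (Θ refr ξ)) ⊎ (suc r ≡ len β × StateOf (suc β) 0 (Θ refr ξ))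
  advance {β} {r} (σ , i , ε) r<len s = go (State.direction s) (ℕₚ.m≤n⇒m<n∨m≡n r<len) s
    where
    go : ∀ {ε} → ε ≡ sgn β → suc r < len β ⊎ suc r ≡ len β → State β r σ i ε →
         (suc r < len β × StateOf β (suc r) (Θ refr (σ , i , ε))) ⊎
         (suc r ≡ len β × StateOf (suc β) 0 (Θ refr (σ , i , ε)))
    go refl (inj₁ r<) s = inj₁ (r< , Advance.jump s r<)
    go refl (inj₂ r≡) s = inj₂ (r≡ , Advance.meet s r≡)

  time : ℕ → ℕ
  time zero    = 0
  time (suc β) = time β + len β

  -- Time runs from the beginning of carry 0, so the clock already shows `r₀` at x.
  reach : ∀ {r₀} x → r₀ < len 0 → StateOf 0 r₀ x → ∀ k →
          ∃[ β ] ∃[ r ] r < len β × time β + r ≡ k + r₀ × StateOf β r (iter (Θ refr) k x)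
  reach {r₀} x r₀<len s zero = 0 , r₀ , r₀<len , refl , s
  reach {r₀} x r₀<len s (suc k) with reach x r₀<len s k
  ... | β , r , r<len , t , s′ with advance (iter (Θ refr) k x) r<len s′
  ... | inj₁ (r< , s″) = β , suc r , r< , trans (ℕₚ.+-suc (time β) r) (cong suc t) , s″
  ... | inj₂ (r≡ , s″) = suc β , 0 , len>0 (suc β) ,
    trans (ℕₚ.+-identityʳ _) (trans (cong (time β ℕ.+_) (sym r≡)) (trans (ℕₚ.+-suc (time β) r) (cong suc t))) , s″

  private
    time-mono-< : ∀ {β β′} → β < β′ → time β + len β ≤ time β′
    time-mono-< {β} {suc β′} (s≤s β≤β′) with ℕₚ.m≤n⇒m<n∨m≡n β≤β′
    ... | inj₁ β<β′ = ℕₚ.≤-trans (time-mono-< β<β′) (ℕₚ.m≤m+n (time β′) (len β′))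
    ... | inj₂ refl = ℕₚ.≤-refl

    time-overtake : ∀ {β β′ r r′} → β < β′ → r < len β → time β + r < time β′ + r′
    time-overtake {β} {β′} {r} {r′} β<β′ r<len =
      ℕₚ.<-≤-trans (ℕₚ.+-monoʳ-< (time β) r<len) (ℕₚ.≤-trans (time-mono-< β<β′) (ℕₚ.m≤m+n (time β′) r′))

  time-unique : ∀ {β β′ r r′} → r < len β → r′ < len β′ → time β + r ≡ time β′ + r′ → β ≡ β′ × r ≡ r′
  time-unique {β} {β′} {r} {r′} r< r′< eq with ℕₚ.<-cmp β β′
  ... | tri< β<β′ _ _ = contradiction eq (ℕₚ.<⇒≢ (time-overtake β<β′ r<))
  ... | tri> _ _ β′<β = contradiction (sym eq) (ℕₚ.<⇒≢ (time-overtake β′<β r′<))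
  ... | tri≈ _ refl _ = refl , ℕₚ.+-cancelˡ-≡ (time β) r r′ eq

  -- When two states coincide

  record Same (β r β′ r′ : ℕ) : Set where
    constructor same
    field
      vertex : v β ≡ v β′
      origin : X β r ≡ X β′ r′ [mod n ]
      spots  : ∀ j → 1 ≤ j → j ≤ n′ → Q (β + j) ⊖ X β r ≡ Q (β′ + j) ⊖ X β′ r′ [mod n′ ]

  private
    v-shift : ∀ {β β′} → v β ≡ v β′ → ∀ j → v (β + j) ≡ v (β′ + j)
    v-shift {β} {β′} eq j = trans (v-+ β j) (trans (cong (steps d j) eq) (sym (v-+ β′ j)))

    relative-place : ∀ {σ i ε x k} (s : Spot σ i ε x k) → Q k ⊖ x ≡ ⟦ ε ⟧ ⊗ + Spot.distance s [mod n′ ]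
    relative-place {ε = ε} {x} {k} s =
      mod-cast refl (mod-+ʳ (⊝ x) (Spot.place s)) (ring x (⟦ ε ⟧ ⊗ + Spot.distance s))
      where ring : ∀ x y → x ⊕ y ⊖ x ≡ y
            ring = solve-∀

    own-injective : ∀ ε {i i′ : Fin n} → own ε i ≡ own ε i′ → i ≡ i′
    own-injective pos eq = eq
    own-injective neg {i} {i′} eq = toℤ-injective (mod-cast (unit (toℤ i))
      (mod-+ʳ -1ℤ (mod-trans (mod-sym (toℤ-sucMod i)) (subst (λ u → toℤ u ≡ toℤ i′ ⊕ 1ℤ [mod n ]) (sym eq) (toℤ-sucMod i′))))
      (sym (unit (toℤ i′))))
      where unit : ∀ x → x ≡ x ⊕ 1ℤ ⊕ -1ℤ
            unit = solve-∀

  -- The carrier determines the direction through `Y`, its origin modulo n determines i, and the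
  -- places relative to it determine all distances and so all labels. Absolute places need not
  -- agree.
  same⇒≈ : ∀ {β r β′ r′} ξ ξ′ → StateOf β r ξ → StateOf β′ r′ ξ′ → Same β r β′ r′ → ξ ≈Ξ ξ′
  same⇒≈ {β} {r} {β′} {r′} (σ , i , ε) (σ′ , i′ , ε′) (state refl car here oth) (state refl car′ here′ oth′)
    (same vtx org spt) = go (cong (λ u → signOf (Y u)) vtx) car here oth car′ here′ oth′
    where
    go : ∀ {ε ε′} → ε ≡ ε′ → σ ⟨$⟩ʳ v β ≡ own ε i → toℤ (own ε i) ≡ X β r ⊕ lag ε [mod n ] →
         (∀ j → 1 ≤ j → j ≤ n′ → Spot σ i ε (X β r) (β + j)) →
         σ′ ⟨$⟩ʳ v β′ ≡ own ε′ i′ → toℤ (own ε′ i′) ≡ X β′ r′ ⊕ lag ε′ [mod n ] →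
         (∀ j → 1 ≤ j → j ≤ n′ → Spot σ′ i′ ε′ (X β′ r′) (β′ + j)) → (σ , i , ε) ≈Ξ (σ′ , i′ , ε′)
    go {ε} refl car here oth car′ here′ oth′ = labels , own-injective ε own≡ , refl
      where
      own≡ : own ε i ≡ own ε i′
      own≡ = toℤ-injective (mod-trans here (mod-trans (mod-+ʳ (lag ε) org) (mod-sym here′)))
      at : ∀ j → j ≤ n′ → σ ⟨$⟩ʳ v (β + j) ≡ σ′ ⟨$⟩ʳ v (β + j)
      at zero _ = trans (cong (λ k → σ ⟨$⟩ʳ v k) (ℕₚ.+-identityʳ β)) (trans car (trans own≡ (trans (sym car′)
        (cong (σ′ ⟨$⟩ʳ_) (trans (sym vtx) (cong v (sym (ℕₚ.+-identityʳ β))))))))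
      at j@(suc _) j≤n′ = toℤ-injective (mod-trans (Spot.label s) (mod-trans
        (mod-reflexive (cong₂ (λ o E → toℤ o ⊕ ⟦ ε ⟧ ⊗ + E) own≡ E≡E′))
        (mod-trans (mod-sym (Spot.label s′)) (mod-reflexive (cong (λ u → toℤ (σ′ ⟨$⟩ʳ u)) (sym (v-shift vtx j)))))))
        where
        s = oth j (s≤s z≤n) j≤n′
        s′ = oth′ j (s≤s z≤n) j≤n′
        E≡E′ : Spot.distance s ≡ Spot.distance s′
        E≡E′ = mod-small⁺ (Spot.distance≥1 s) (Spot.distance≤ s) (Spot.distance≥1 s′) (Spot.distance≤ s′)
          (⟦⟧-cancel ε (mod-trans (mod-sym (relative-place s)) (mod-trans (spt j (s≤s z≤n) j≤n′) (relative-place s′))))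
      labels : ∀ u → σ ⟨$⟩ʳ u ≡ σ′ ⟨$⟩ʳ u
      labels u with v-surjective β u
      ... | j , s≤s j≤n′ , refl = at j j≤n′

  ≈⇒same : ∀ {β r β′ r′} ξ ξ′ → StateOf β r ξ → StateOf β′ r′ ξ′ → ξ ≈Ξ ξ′ → Same β r β′ r′
  ≈⇒same {β} {r} {β′} {r′} (σ , i , ε) (σ′ , .i , .ε) (state _ car here oth) (state _ car′ here′ oth′) (σ≈ , refl , refl) =
    same vtx (mod-cast (ring (X β r) (lag ε)) (mod-+ʳ (⊝ lag ε) (mod-trans (mod-sym here) here′)) (sym (ring (X β′ r′) (lag ε)))) spt
    where
    ring : ∀ x l → x ≡ x ⊕ l ⊖ l
    ring = solve-∀
    vtx : v β ≡ v β′
    vtx = trans (sym (inverseˡ σ′)) (trans (cong (σ′ ⟨$⟩ˡ_) (trans (sym (σ≈ (v β))) (trans car (sym car′)))) (inverseˡ σ′))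
    spt : ∀ j → 1 ≤ j → j ≤ n′ → Q (β + j) ⊖ X β r ≡ Q (β′ + j) ⊖ X β′ r′ [mod n′ ]
    spt j 1≤j j≤n′ = mod-trans (relative-place s) (mod-trans (mod-reflexive (cong (λ E → ⟦ ε ⟧ ⊗ + E) E≡E′)) (mod-sym (relative-place s′)))
      where
      s = oth j 1≤j j≤n′
      s′ = oth′ j 1≤j j≤n′
      E≡E′ : Spot.distance s ≡ Spot.distance s′
      E≡E′ = mod-small (s≤s (Spot.distance≤ s)) (s≤s (Spot.distance≤ s′))
        (⟦⟧-cancel ε (mod-+-cancelˡ (toℤ (own ε i)) (mod-trans (mod-sym (Spot.label s))
          (mod-trans (mod-reflexive (cong toℤ (trans (σ≈ (v (β + j))) (cong (σ′ ⟨$⟩ʳ_) (v-shift vtx j))))) (Spot.label s′)))))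

-- Finite sums and periods

∑ : (ℕ → ℕ) → ℕ → ℕ
∑ f n = sum (applyUpTo f n)

∑-cong : ∀ {f g} n → (∀ i → i < n → f i ≡ g i) → ∑ f n ≡ ∑ g n
∑-cong zero    eq = refl
∑-cong (suc n) eq = cong₂ _+_ (eq 0 (s≤s z≤n)) (∑-cong n (λ i i<n → eq (suc i) (s≤s i<n)))

∑-++ : ∀ f m n → ∑ f (m + n) ≡ ∑ f m + ∑ (λ i → f (m + i)) n
∑-++ f zero    n = refl
∑-++ f (suc m) n = trans (cong (f 0 ℕ.+_) (∑-++ (f ∘ suc) m n)) (sym (ℕₚ.+-assoc (f 0) _ _))

∑-suc : ∀ f n → ∑ f (suc n) ≡ ∑ f n + f n
∑-suc f zero    = ℕₚ.+-identityʳ (f 0)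
∑-suc f (suc n) = trans (cong (f 0 ℕ.+_) (∑-suc (f ∘ suc) n)) (sym (ℕₚ.+-assoc (f 0) _ _))

∑-+ : ∀ f g n → ∑ (λ i → f i + g i) n ≡ ∑ f n + ∑ g n
∑-+ f g zero    = refl
∑-+ f g (suc n) = trans (cong (f 0 + g 0 ℕ.+_) (∑-+ (f ∘ suc) (g ∘ suc) n)) (interchange (f 0) (g 0) _ _)
  where interchange : ∀ a b c d → a + b + (c + d) ≡ a + c + (b + d)
        interchange = solve-∀ℕ

∑-const : ∀ c n → ∑ (λ _ → c) n ≡ n * c
∑-const c zero    = refl
∑-const c (suc n) = cong (c ℕ.+_) (∑-const c n)

∑-comm : ∀ (f : ℕ → ℕ → ℕ) m n → ∑ (λ i → ∑ (f i) n) m ≡ ∑ (λ j → ∑ (λ i → f i j) m) n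
∑-comm f zero    n = sym (trans (∑-const 0 n) (ℕₚ.*-zeroʳ n))
∑-comm f (suc m) n = trans (cong (∑ (f 0) n ℕ.+_) (∑-comm (f ∘ suc) m n))
  (sym (∑-+ (f 0) (λ j → ∑ (λ i → f (suc i) j) m) n))

∑-blocks : ∀ f m n → ∑ f (m * n) ≡ ∑ (λ i → ∑ (λ j → f (i * n + j)) n) m
∑-blocks f zero    n = refl
∑-blocks f (suc m) n = trans (∑-++ f n (m * n)) (cong (∑ f n ℕ.+_) (trans (∑-blocks (λ i → f (n + i)) m n)
  (∑-cong m λ i _ → ∑-cong n λ j _ → cong f (sym (ℕₚ.+-assoc n (i * n) j)))))

period-* : ∀ {a p} → IsPeriod a p → ∀ k → IsPeriod a (k * p)
period-* {a} per zero    β = cong a (ℕₚ.+-identityʳ β)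
period-* {a} {p} per (suc k) β = trans (cong a (sym (ℕₚ.+-assoc β p (k * p))))
  (trans (period-* {a} per k (β + p)) (per β))

-- Either sum, together with `∑ f s`, is the sum over the first s + p indices.
∑-period-shift : ∀ {f p} → IsPeriod f p → ∀ s → ∑ (λ i → f (i + s)) p ≡ ∑ f p
∑-period-shift {f} {p} per s = ℕₚ.+-cancelˡ-≡ (∑ f s) _ _ (begin
  ∑ f s + ∑ (λ i → f (i + s)) p ≡⟨ cong (∑ f s ℕ.+_) (∑-cong p λ i _ → cong f (ℕₚ.+-comm i s)) ⟩
  ∑ f s + ∑ (λ i → f (s + i)) p ≡⟨ ∑-++ f s p ⟨
  ∑ f (s + p)                   ≡⟨ cong (∑ f) (ℕₚ.+-comm s p) ⟩
  ∑ f (p + s)                   ≡⟨ ∑-++ f p s ⟩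
  ∑ f p + ∑ (λ i → f (p + i)) s ≡⟨ cong (∑ f p ℕ.+_) (∑-cong s λ i _ → trans (cong f (ℕₚ.+-comm p i)) (per i)) ⟩
  ∑ f p + ∑ f s                 ≡⟨ ℕₚ.+-comm (∑ f p) (∑ f s) ⟩
  ∑ f s + ∑ f p                 ∎)
  where open ≡-Reasoning

∑-period-* : ∀ {f p} → IsPeriod f p → ∀ k → ∑ f (k * p) ≡ k * ∑ f p
∑-period-* {f} {p} per k = trans (∑-blocks f k p) (trans
  (∑-cong k λ i _ → ∑-cong p λ j _ → trans (cong f (ℕₚ.+-comm (i * p) j)) (period-* {f} per i j))
  (∑-const (∑ f p) k))

-- A nonzero remainder of q modulo p would be a smaller period.
minimalPeriod-∣ : ∀ {a p q} → IsMinimalPeriod a p → IsPeriod a q → p ∣ q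
minimalPeriod-∣ {a} {p@(suc _)} {q} (_ , per , minimal) per-q with q ℕ.% p in eq
... | zero  = m%n≡0⇒n∣m q p eq
... | suc r = contradiction per-r (minimal (suc r) (s≤s z≤n) (subst (_< p) eq (ℕ.m%n<n q p)))
  where
  per-r : IsPeriod a (suc r)
  per-r β = trans (sym (period-* {a} per (q ℕ./ p) (β + suc r))) (trans (cong a (trans (ℕₚ.+-assoc β (suc r) _)
    (cong (β ℕ.+_) (sym (trans (ℕ.m≡m%n+[m/n]*n q p) (cong (_+ q ℕ./ p * p) eq)))))) (per-q β))

-- Counting over vertices and inside arcs

sumᵥ-toℕ : ∀ n (f : ℕ → ℕ) → sumᵥ {n} (f ∘ toℕ) ≡ ∑ f n
sumᵥ-toℕ zero    f = refl
sumᵥ-toℕ (suc n) f = cong (f 0 ℕ.+_) (sumᵥ-toℕ n (f ∘ suc))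

sumᵥ-allFin : ∀ {n} (f : Fin n → ℕ) → sumᵥ f ≡ sum (map f (allFin n))
sumᵥ-allFin f = trans (go f) (cong sum (sym (Listₚ.map-tabulate (λ i → i) f)))
  where
  go : ∀ {n} (f : Fin n → ℕ) → sumᵥ f ≡ sum (tabulate f)
  go {zero}  f = refl
  go {suc n} f = cong (f Fin.zero ℕ.+_) (go (f ∘ Fin.suc))

⟨_⟩ : Bool → ℕ
⟨ b ⟩ = if b then 1 else 0

∑-below : ∀ {y} n → y ≤ n → ∑ (λ z → ⟨ z <ᵇ y ⟩) n ≡ y
∑-below {zero}  n       _         = trans (∑-const 0 n) (ℕₚ.*-zeroʳ n)
∑-below {suc y} (suc n) (s≤s y≤n) = cong suc (∑-below n y≤n)

<ᵇ-true : ∀ {m n} → m < n → (m <ᵇ n) ≡ true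
<ᵇ-true m<n = Equivalence.to Boolₚ.T-≡ (ℕₚ.<⇒<ᵇ m<n)

<ᵇ-true⁻¹ : ∀ m n → (m <ᵇ n) ≡ true → m < n
<ᵇ-true⁻¹ m n eq = ℕₚ.<ᵇ⇒< m n (Equivalence.from Boolₚ.T-≡ eq)

<ᵇ-false⁻¹ : ∀ m n → (m <ᵇ n) ≡ false → n ≤ m
<ᵇ-false⁻¹ m n eq = ℕₚ.≮⇒≥ λ m<n → contradiction (trans (sym eq) (<ᵇ-true m<n)) λ ()

<ᵇ-not : ∀ x z → (x <ᵇ z) ≡ not (z <ᵇ suc x)
<ᵇ-not zero    zero    = refl
<ᵇ-not zero    (suc z) = refl
<ᵇ-not (suc x) zero    = refl
<ᵇ-not (suc x) (suc z) = <ᵇ-not x z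

-- The arc and the z ≤ x together fill z < y without overlap.
∑-arc-< : ∀ {x y} n → x < y → y ≤ n → ∑ (λ z → ⟨ inArc x y z ⟩) n + suc x ≡ y
∑-arc-< {x} {y} n x<y y≤n = begin
  ∑ (λ z → ⟨ inArc x y z ⟩) n + suc x ≡⟨ cong (∑ (λ z → ⟨ inArc x y z ⟩) n ℕ.+_) (∑-below n (ℕₚ.≤-trans x<y y≤n)) ⟨
  ∑ (λ z → ⟨ inArc x y z ⟩) n + ∑ (λ z → ⟨ z <ᵇ suc x ⟩) n ≡⟨ ∑-+ (λ z → ⟨ inArc x y z ⟩) (λ z → ⟨ z <ᵇ suc x ⟩) n ⟨
  ∑ (λ z → ⟨ inArc x y z ⟩ + ⟨ z <ᵇ suc x ⟩) n ≡⟨ ∑-cong n (λ z _ → pointwise z) ⟩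
  ∑ (λ z → ⟨ z <ᵇ y ⟩) n ≡⟨ ∑-below n y≤n ⟩
  y ∎
  where
  open ≡-Reasoning
  bool : ∀ a b → (a ≡ true → b ≡ true) → ⟨ not a ∧ b ⟩ + ⟨ a ⟩ ≡ ⟨ b ⟩
  bool true  b     imp rewrite imp refl = refl
  bool false true  imp = refl
  bool false false imp = refl
  pointwise : ∀ z → ⟨ inArc x y z ⟩ + ⟨ z <ᵇ suc x ⟩ ≡ ⟨ z <ᵇ y ⟩
  pointwise z rewrite <ᵇ-true x<y | <ᵇ-not x z = bool (z <ᵇ suc x) (z <ᵇ y) λ z≤x →
    <ᵇ-true (ℕₚ.≤-trans (<ᵇ-true⁻¹ z (suc x) z≤x) x<y)

-- The arc wraps: with the z ≤ x added it covers everything once, and the z < y a second time.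
∑-arc-≥ : ∀ {x y} n → y ≤ x → x < n → ∑ (λ z → ⟨ inArc x y z ⟩) n + suc x ≡ n + y
∑-arc-≥ {x} {y} n y≤x x<n = begin
  ∑ (λ z → ⟨ inArc x y z ⟩) n + suc x ≡⟨ cong (∑ (λ z → ⟨ inArc x y z ⟩) n ℕ.+_) (∑-below n x<n) ⟨
  ∑ (λ z → ⟨ inArc x y z ⟩) n + ∑ (λ z → ⟨ z <ᵇ suc x ⟩) n ≡⟨ ∑-+ (λ z → ⟨ inArc x y z ⟩) (λ z → ⟨ z <ᵇ suc x ⟩) n ⟨
  ∑ (λ z → ⟨ inArc x y z ⟩ + ⟨ z <ᵇ suc x ⟩) n ≡⟨ ∑-cong n (λ z _ → pointwise z) ⟩
  ∑ (λ z → 1 + ⟨ z <ᵇ y ⟩) n ≡⟨ ∑-+ (λ _ → 1) (λ z → ⟨ z <ᵇ y ⟩) n ⟩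
  ∑ (λ _ → 1) n + ∑ (λ z → ⟨ z <ᵇ y ⟩) n ≡⟨ cong₂ _+_ (trans (∑-const 1 n) (ℕₚ.*-identityʳ n)) (∑-below n (ℕₚ.≤-trans y≤x (ℕₚ.<⇒≤ x<n))) ⟩
  n + y ∎
  where
  open ≡-Reasoning
  bool : ∀ a b → (b ≡ true → a ≡ true) → ⟨ not a ∨ b ⟩ + ⟨ a ⟩ ≡ 1 + ⟨ b ⟩
  bool true  true  imp = refl
  bool true  false imp = refl
  bool false true  imp = contradiction (imp refl) λ ()
  bool false false imp = refl
  x≮y : (x <ᵇ y) ≡ false
  x≮y = Boolₚ.¬-not λ eq → ℕₚ.≤⇒≯ y≤x (<ᵇ-true⁻¹ x y eq)
  pointwise : ∀ z → ⟨ inArc x y z ⟩ + ⟨ z <ᵇ suc x ⟩ ≡ 1 + ⟨ z <ᵇ y ⟩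
  pointwise z rewrite x≮y | <ᵇ-not x z = bool (z <ᵇ suc x) (z <ᵇ y) λ z<y →
    <ᵇ-true (ℕₚ.≤-trans (<ᵇ-true⁻¹ z y z<y) (ℕₚ.≤-trans y≤x (ℕₚ.n≤1+n x)))

-- Labels along the cycle

predMod-sucMod : ∀ {n} (i : Fin n) → predMod (sucMod i) ≡ i
predMod-sucMod i = toℤ-injective (mod-trans (toℤ-predMod _)
  (mod-cast refl (mod-+ʳ -1ℤ (toℤ-sucMod i)) (eq (toℤ i))))
  where eq : ∀ i → i ⊕ 1ℤ ⊕ -1ℤ ≡ i
        eq = solve-∀

module WalkSum {n′ : ℕ} (v : ℕ → Fin (suc n′)) (d : Sgn) (v-suc : ∀ β → v (suc β) ≡ step d (v β)) where
  open Walk v d v-suc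

  visits : Permutation′ (suc n′)
  visits = permutation (v ∘ toℕ) (λ u → Fin.fromℕ< (index< u)) right left
    where
    index< : ∀ u → proj₁ (v-surjective 0 u) < suc n′
    index< u = proj₁ (proj₂ (v-surjective 0 u))
    right : ∀ u → v (toℕ (Fin.fromℕ< (index< u))) ≡ u
    right u = trans (cong v (Finₚ.toℕ-fromℕ< (index< u))) (proj₂ (proj₂ (v-surjective 0 u)))
    left : ∀ i → Fin.fromℕ< (index< (v (toℕ i))) ≡ i
    left i = Finₚ.toℕ-injective (v-injective 0 _ _ (Finₚ.toℕ<n (Fin.fromℕ< (index< (v (toℕ i))))) (Finₚ.toℕ<n i) (right (v (toℕ i))))

  ∑-walk : ∀ (f : Fin (suc n′) → ℕ) → ∑ (f ∘ v) (suc n′) ≡ sumᵥ f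
  ∑-walk f = trans (sym (sumᵥ-toℕ (suc n′) (f ∘ v))) (sym (sum-permute f visits))

  ∑-walk-label : ∀ (σ : Permutation′ (suc n′)) (f : ℕ → ℕ) →
                 ∑ (λ k → f (toℕ (σ ⟨$⟩ʳ v k))) (suc n′) ≡ ∑ f (suc n′)
  ∑-walk-label σ f = trans (∑-walk (λ u → f (toℕ (σ ⟨$⟩ʳ u))))
    (trans (sym (sum-permute (f ∘ toℕ) σ)) (sumᵥ-toℕ (suc n′) f))

module Labels {n′ : ℕ} (hn : 3 ≤ suc n′) (σ : Permutation′ (suc n′)) where

  v : ℕ → Fin (suc n′)
  v = vert hn σ

  open Walk v (dir hn σ) (λ _ → refl)
  open WalkSum v (dir hn σ) (λ _ → refl)

  private
    2≤n′ : 2 ≤ n′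
    2≤n′ = ℕₚ.≤-pred hn

    1≤n′ : 1 ≤ n′
    1≤n′ = ℕₚ.≤-trans (s≤s z≤n) 2≤n′

  instance
    n′-nonZero : NonZero n′
    n′-nonZero = nz-pred hn

  label : ℕ → ℕ
  label = lab hn σ

  label-0 : label 0 ≡ 0
  label-0 = cong toℕ (inverseʳ σ)

  label≤ : ∀ k → label k ≤ n′
  label≤ k = ℕₚ.≤-pred (Finₚ.toℕ<n (σ ⟨$⟩ʳ v k))

  label-injective : ∀ {j k} → j ≤ n′ → k ≤ n′ → label j ≡ label k → j ≡ k
  label-injective {j} {k} j≤ k≤ eq = v-injective 0 j k (s≤s j≤) (s≤s k≤)
    (trans (sym (inverseˡ σ)) (trans (cong (σ ⟨$⟩ˡ_) (Finₚ.toℕ-injective eq)) (inverseˡ σ)))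

  label≥1 : ∀ {k} → 1 ≤ k → k ≤ n′ → 1 ≤ label k
  label≥1 {k} 1≤k k≤n′ = ℕₚ.n≢0⇒n>0 λ eq →
    ℕₚ.<⇒≢ 1≤k (sym (label-injective k≤n′ z≤n (trans eq (sym label-0))))

  -- With the term of `v 0`, which has label 0, added on both sides, the sum runs over all vertices
  -- and can be rearranged by labels.
  arcCount-∑ : ∀ x y → arcCount hn σ x y ≡ suc (∑ (λ z → ⟨ inArc x y (suc z) ⟩) n′)
  arcCount-∑ x y = cong suc (trans (cong sum (Listₚ.map-applyUpTo suc (λ k → ⟨ inArc x y (label k) ⟩) n′))
    (ℕₚ.+-cancelˡ-≡ ⟨ inArc x y 0 ⟩ _ _ (trans (cong (λ l → ⟨ inArc x y l ⟩ + ∑ (λ k → ⟨ inArc x y (label (suc k)) ⟩) n′) (sym label-0))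
      (∑-walk-label σ (λ z → ⟨ inArc x y z ⟩)))))

  -- With `arcCount-≥` this identifies `arcCount` as the upward step from x to y in the cyclic order
  -- of the n - 1 nonzero labels. `inArc` is unchanged when all its arguments drop by one, which
  -- lets those labels start at 0.
  arcCount-< : ∀ {x y} → 1 ≤ x → x < y → y ≤ n′ → arcCount hn σ x y + x ≡ y
  arcCount-< {suc x} {suc y} _ (s≤s x<y) y≤n′ = trans (cong (_+ suc x) (arcCount-∑ (suc x) (suc y)))
    (cong suc (∑-arc-< n′ x<y (ℕₚ.<⇒≤ y≤n′)))

  arcCount-≥ : ∀ {x y} → 1 ≤ y → y ≤ x → x ≤ n′ → arcCount hn σ x y + x ≡ n′ + y
  arcCount-≥ {suc x} {suc y} _ (s≤s y≤x) x≤n′ = trans (cong (_+ suc x) (arcCount-∑ (suc x) (suc y)))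
    (trans (cong suc (∑-arc-≥ n′ y≤x x≤n′)) (sym (ℕₚ.+-suc n′ y)))

  label-last : label 1 < label n′
  label-last = go (toℕ (σ ⟨$⟩ʳ sucMod (v 0)) <ᵇ toℕ (σ ⟨$⟩ʳ predMod (v 0))) refl
    where
    before : Sgn → Fin (suc n′) → Fin (suc n′)
    before ε = step (negate ε)
    before-step : ∀ ε u → before ε (step ε u) ≡ u
    before-step pos = predMod-sucMod
    before-step neg = sucMod-predMod
    v-last : v n′ ≡ before (dir hn σ) (v 0)
    v-last = trans (sym (before-step (dir hn σ) (v n′))) (cong (before (dir hn σ)) (v-periodic 0))
    go : ∀ b → (toℕ (σ ⟨$⟩ʳ sucMod (v 0)) <ᵇ toℕ (σ ⟨$⟩ʳ predMod (v 0))) ≡ b → label 1 < label n′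
    go true eq = subst₂ (λ a b → toℕ (σ ⟨$⟩ʳ a) < toℕ (σ ⟨$⟩ʳ b))
      (cong (λ b → step (if b then pos else neg) (v 0)) (sym eq))
      (sym (trans v-last (cong (λ b → before (if b then pos else neg) (v 0)) eq)))
      (<ᵇ-true⁻¹ _ _ eq)
    -- The failed test yields only ≤; strictness holds because v_1 and v_{n-1} are distinct for n ≥
    -- 3.
    go false eq = ℕₚ.≤∧≢⇒< (subst₂ (λ a b → toℕ (σ ⟨$⟩ʳ a) ≤ toℕ (σ ⟨$⟩ʳ b))
      (cong (λ b → step (if b then pos else neg) (v 0)) (sym eq))
      (sym (trans v-last (cong (λ b → before (if b then pos else neg) (v 0)) eq)))
      (<ᵇ-false⁻¹ _ _ eq))
      (λ eq′ → ℕₚ.<⇒≢ 2≤n′ (label-injective 1≤n′ ℕₚ.≤-refl eq′))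

  a : ℕ → ℕ
  a = aSeq hn σ

  -- Place 0 is that of v_{n-1}, not of v_n.
  spotIndex : ℕ → ℕ
  spotIndex zero    = n′
  spotIndex (suc j) = suc j

  q : ℕ → ℕ
  q β = label (spotIndex (β ℕ.% n′))

  q-periodic : ∀ β → q (β + n′) ≡ q β
  q-periodic β = cong (label ∘ spotIndex) (ℕ.[m+n]%n≡m%n β n′)

  a-periodic : IsPeriod a n′
  a-periodic β = cong (aFin hn σ) (ℕ.[m+n]%n≡m%n β n′)

  a-aFin : ∀ {j} → j < n′ → a j ≡ aFin hn σ j
  a-aFin j<n′ = cong (aFin hn σ) (ℕ.m<n⇒m%n≡m j<n′)

  q-label : ∀ {j} → 1 ≤ j → j ≤ n′ → q j ≡ label j
  q-label {suc j} _ j≤n′ with ℕₚ.m≤n⇒m<n∨m≡n j≤n′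
  ... | inj₁ j<n′ = cong (label ∘ spotIndex) (ℕ.m<n⇒m%n≡m j<n′)
  ... | inj₂ refl = cong (label ∘ spotIndex) (ℕ.n%n≡0 (suc j))

  private
    q-suc : ∀ β → q (suc β) ≡ label (suc (β ℕ.% n′))
    q-suc β = trans (cong q (cong suc (ℕ.m≡m%n+[m/n]*n β n′)))
      (trans (cong (label ∘ spotIndex) (ℕ.[m+kn]%n≡m%n (suc (β ℕ.% n′)) (β ℕ./ n′) n′))
        (q-label (s≤s z≤n) (ℕ.m%n<n β n′)))

    aFin-arc : ∀ j → aFin hn σ j ≡ arcCount hn σ (label (spotIndex j)) (label (suc j))
    aFin-arc zero    = refl
    aFin-arc (suc j) = refl

    spotIndex≥1 : ∀ j → 1 ≤ spotIndex j
    spotIndex≥1 zero    = 1≤n′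
    spotIndex≥1 (suc j) = s≤s z≤n

    spotIndex≤ : ∀ {j} → j < n′ → spotIndex j ≤ n′
    spotIndex≤ {zero}  _    = ℕₚ.≤-refl
    spotIndex≤ {suc j} j<n′ = ℕₚ.<⇒≤ j<n′

    spotIndex-≢ : ∀ j → spotIndex j ≢ suc j
    spotIndex-≢ zero    eq = ℕₚ.<⇒≢ 2≤n′ (sym eq)
    spotIndex-≢ (suc j) ()

  a≥1 : ∀ β → 1 ≤ a β
  a≥1 β = subst (1 ≤_) (sym (aFin-arc (β ℕ.% n′))) (s≤s z≤n)

  a-q : ∀ β → (a β + q β ≡ q (suc β) × q β < q (suc β)) ⊎ (a β + q β ≡ n′ + q (suc β) × q (suc β) < q β)
  a-q β = subst (λ y → (a β + q β ≡ y × q β < y) ⊎ (a β + q β ≡ n′ + y × y < q β)) (sym (q-suc β)) (go (ℕₚ.m≤n⇒m<n∨m≡n {y} {x} ∘ ℕₚ.≮⇒≥))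
    where
    j = β ℕ.% n′
    j<n′ = ℕ.m%n<n β n′
    x = q β
    y = label (suc j)
    x≥1 : 1 ≤ x
    x≥1 = label≥1 (spotIndex≥1 j) (spotIndex≤ j<n′)
    y≥1 : 1 ≤ y
    y≥1 = label≥1 (s≤s z≤n) j<n′
    x≢y : x ≢ y
    x≢y eq = spotIndex-≢ j (label-injective (spotIndex≤ j<n′) j<n′ eq)
    go : (¬ (x < y) → y < x ⊎ y ≡ x) → (a β + x ≡ y × x < y) ⊎ (a β + x ≡ n′ + y × y < x)
    go geq with x ℕ.<? y
    ... | yes x<y = inj₁ (trans (cong (_+ x) (aFin-arc j)) (arcCount-< x≥1 x<y (label≤ (suc j))) , x<y)
    ... | no x≮y with geq x≮y
    ...   | inj₁ y<x = inj₂ (trans (cong (_+ x) (aFin-arc j)) (arcCount-≥ y≥1 (ℕₚ.<⇒≤ y<x) (label≤ (spotIndex j))) , y<x)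
    ...   | inj₂ y≡x = contradiction (sym y≡x) x≢y

  a<n′ : ∀ β → a β < n′
  a<n′ β with a-q β
  ... | inj₁ (eq , _) = ℕₚ.<-≤-trans (subst (a β <_) eq (ℕₚ.m<m+n (a β) (label≥1 (spotIndex≥1 (β ℕ.% n′)) (spotIndex≤ (ℕ.m%n<n β n′)))))
                          (label≤ (spotIndex (suc β ℕ.% n′)))
  ... | inj₂ (eq , y<x) = ℕₚ.+-cancelʳ-< (q β) (a β) n′ (subst (_< n′ + q β) (sym eq) (ℕₚ.+-monoʳ-< n′ y<x))

  q-step : ∀ β → + q (suc β) ≡ + q β ⊕ + a β [mod n′ ]
  q-step β with a-q β
  ... | inj₁ (eq , _) = mod-reflexive (cong +_ (trans (sym eq) (ℕₚ.+-comm (a β) (q β))))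
  ... | inj₂ (eq , _) = mod-sym (multiple 1ℤ (trans (cong +_ (trans (ℕₚ.+-comm (q β) (a β)) (trans eq (ℕₚ.+-comm n′ (q (suc β))))))
    (ring (+ q (suc β)) (+ n′))))
    where ring : ∀ x m → x ⊕ m ≡ x ⊕ 1ℤ ⊗ m
          ring = solve-∀

  -- Since `label 1 < label n′`, the arc defining a_0 wraps, and a_0 exceeds the left-hand side by
  -- `label 1`.
  start<a₀ : n′ ∸ label n′ < a 0
  start<a₀ = ℕₚ.+-cancelʳ-< (label n′) (n′ ∸ label n′) (a 0) (begin-strict
    n′ ∸ label n′ + label n′ ≡⟨ ℕₚ.m∸n+n≡m (label≤ n′) ⟩
    n′                       <⟨ ℕₚ.m<m+n n′ (label≥1 (s≤s z≤n) 1≤n′) ⟩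
    n′ + label 1             ≡⟨ arcCount-≥ (label≥1 (s≤s z≤n) 1≤n′) (ℕₚ.<⇒≤ label-last) (label≤ n′) ⟨
    arcCount hn σ (label n′) (label 1) + label n′ ≡⟨ cong (_+ label n′) (a-aFin 1≤n′) ⟨
    a 0 + label n′           ∎)
    where open ℕₚ.≤-Reasoning

-- The orbit

module Orbit {n′ : ℕ} (hn : 3 ≤ suc n′) (refr : Fin (suc n′) → Bool) (σ : Permutation′ (suc n′))
  (p : ℕ) (minimal : IsMinimalPeriod (aSeq hn σ) p) (m : ℕ) (total : aSum hn σ ≡ m * n′)
  (Y : Fin (suc n′) → Bool) (partition : IsSignPartition hn refr σ Y) where

  open Labels hn σ
  open Walk v (dir hn σ) (λ _ → refl)
  open WalkSum v (dir hn σ) (λ _ → refl)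

  private
    n = suc n′
    μ = count Y

    2≤n′ : 2 ≤ n′
    2≤n′ = ℕₚ.≤-pred hn

  refr-Y : ∀ k → refr k ≡ Y k xor Y (sucMod k)
  refr-Y k = go (refr k) (Y k) (Y (sucMod k)) (proj₁ (proj₂ partition k)) (proj₂ (proj₂ partition k))
    where
    go : ∀ r y y′ → (r ≡ true → ¬ (y ≡ y′)) → (r ≡ false → y ≡ y′) → r ≡ y xor y′
    go true  true  true  f g = contradiction refl (f refl)
    go true  true  false f g = refl
    go true  false true  f g = refl
    go true  false false f g = contradiction refl (f refl)
    go false true  true  f g = refl
    go false true  false f g = contradiction (g refl) λ ()
    go false false true  f g = contradiction (g refl) λ ()
    go false false false f g = refl

  lenOf : Bool → ℕ → ℕ
  lenOf true  x = x
  lenOf false x = n′ ∸ x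

  len : ℕ → ℕ
  len β = lenOf (Y (v β)) (a β)

  -- Lifts the starting place of the β-th carrier to ℤ: going down by n − 1 − a_β amounts to adding a_β − (n − 1).
  R : ℕ → ℤ
  R β = + label n′ ⊖ + n′ ⊕ + ∑ a β ⊖ + ∑ (λ i → ⟨ not (Y (v i)) ⟩) β ⊗ + n′

  R-suc : ∀ β → R (suc β) ≡ R β ⊕ ⟦ signOf (Y (v β)) ⟧ ⊗ + len β
  R-suc β = trans (cong₂ (λ A N → + label n′ ⊖ + n′ ⊕ + A ⊖ + N ⊗ + n′)
      (∑-suc a β) (∑-suc (λ i → ⟨ not (Y (v i)) ⟩) β))
    (go (Y (v β)))
    where
    A = ∑ a β
    N = ∑ (λ i → ⟨ not (Y (v i)) ⟩) β
    up : ∀ l A a N m → l ⊕ (A ⊕ a) ⊖ (N ⊕ 0ℤ) ⊗ m ≡ l ⊕ A ⊖ N ⊗ m ⊕ 1ℤ ⊗ a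
    up = solve-∀
    down : ∀ l A a N b → l ⊕ (A ⊕ a) ⊖ (N ⊕ 1ℤ) ⊗ (b ⊕ a) ≡ l ⊕ A ⊖ N ⊗ (b ⊕ a) ⊕ -1ℤ ⊗ b
    down = solve-∀
    go : ∀ y → + label n′ ⊖ + n′ ⊕ + (A + a β) ⊖ + (N + ⟨ not y ⟩) ⊗ + n′ ≡
               + label n′ ⊖ + n′ ⊕ + A ⊖ + N ⊗ + n′ ⊕ ⟦ signOf y ⟧ ⊗ + lenOf y (a β)
    go true  = up (+ label n′ ⊖ + n′) (+ A) (+ a β) (+ N) (+ n′)
    go false = subst (λ m → + label n′ ⊖ + n′ ⊕ + (A + a β) ⊖ + (N + 1) ⊗ + m ≡
                            + label n′ ⊖ + n′ ⊕ + A ⊖ + N ⊗ + m ⊕ -1ℤ ⊗ + (n′ ∸ a β))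
      (ℕₚ.m∸n+n≡m (ℕₚ.<⇒≤ (a<n′ β)))
      (down (+ label n′ ⊖ + n′) (+ A) (+ a β) (+ N) (+ (n′ ∸ a β)))

  Q : ℕ → ℤ
  Q β = + q β

  R-Q : ∀ β → R β ≡ Q β [mod n′ ]
  R-Q β = mod-trans (multiple (⊝ (1ℤ ⊕ + N)) (ring (+ label n′) (+ ∑ a β) (+ N) (+ n′))) (mod-sym (q-∑ β))
    where
    N = ∑ (λ i → ⟨ not (Y (v i)) ⟩) β
    ring : ∀ l A N m → l ⊖ m ⊕ A ⊖ N ⊗ m ≡ l ⊕ A ⊕ ⊝ (1ℤ ⊕ N) ⊗ m
    ring = solve-∀
    q-∑ : ∀ β → + q β ≡ + label n′ ⊕ + ∑ a β [mod n′ ]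
    q-∑ zero = mod-reflexive (cong +_ (trans (cong (label ∘ spotIndex) (ℕ.m<n⇒m%n≡m (ℕₚ.≤-trans (s≤s z≤n) 2≤n′))) (sym (ℕₚ.+-identityʳ _))))
    q-∑ (suc β) = mod-trans (q-step β) (mod-cast refl (mod-+ʳ (+ a β) (q-∑ β))
      (cong +_ (trans (ℕₚ.+-assoc (label n′) (∑ a β) (a β)) (cong (λ s → label n′ + s) (sym (∑-suc a β))))))

  len>0 : ∀ β → 1 ≤ len β
  len>0 β = go (Y (v β))
    where
    go : ∀ y → 1 ≤ lenOf y (a β)
    go true  = a≥1 β
    go false = ℕₚ.m<n⇒0<n∸m (a<n′ β)

  len<n′ : ∀ β → len β < n′
  len<n′ β = go (Y (v β))
    where
    go : ∀ y → lenOf y (a β) < n′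
    go true  = a<n′ β
    go false = ℕₚ.∸-monoʳ-< {o = 0} (a≥1 β) (ℕₚ.<⇒≤ (a<n′ β))

  open Trajectory 2≤n′ refr Y refr-Y v (dir hn σ) (λ _ → refl) Q R len
    (λ β → cong +_ (q-periodic β)) R-Q R-suc len>0 len<n′

  start : Ξ n
  start = σ , Fin.zero , pos

  -- The steps that v_n counts as having made: among the places, its label 0 stands for n - 1, and
  -- its carry began at the place `label n′` of v_{n-1}.
  r₀ : ℕ
  r₀ = n′ ∸ label n′

  Y-v₀ : Y (v 0) ≡ true
  Y-v₀ = proj₁ partition

  len₀ : len 0 ≡ a 0
  len₀ = cong (λ y → lenOf y (a 0)) Y-v₀

  r₀<len : r₀ < len 0
  r₀<len = subst (r₀ <_) (sym len₀) start<a₀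

  -- The summand - (n - 1) in `R` is there for this equation; it makes the distances in the given
  -- state equal to the labels.
  X-start : X 0 r₀ ≡ 0ℤ
  X-start = trans (cong (λ y → R 0 ⊕ ⟦ signOf y ⟧ ⊗ + r₀) Y-v₀)
    (subst (λ m → + label n′ ⊖ + m ⊕ 0ℤ ⊖ 0ℤ ⊗ + m ⊕ 1ℤ ⊗ + r₀ ≡ 0ℤ) (ℕₚ.m∸n+n≡m (label≤ n′))
      (ring (+ label n′) (+ r₀)))
    where ring : ∀ l r → l ⊖ (r ⊕ l) ⊕ 0ℤ ⊖ 0ℤ ⊗ (r ⊕ l) ⊕ 1ℤ ⊗ r ≡ 0ℤ
          ring = solve-∀

  start-state : StateOf 0 r₀ start
  start-state = state (cong signOf (sym Y-v₀)) (inverseʳ σ)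
    (mod-reflexive (sym (trans (ℤₚ.+-identityʳ (X 0 r₀)) X-start)))
    λ j 1≤j j≤n′ → spot (label j) (label≥1 1≤j j≤n′) (label≤ j)
      (mod-reflexive (ring (+ label j)))
      (mod-cast (cong +_ (q-label 1≤j j≤n′)) (mod-reflexive (ring (+ label j)))
        (cong (λ x → x ⊕ 1ℤ ⊗ + label j) (sym X-start)))
    where ring : ∀ l → l ≡ 0ℤ ⊕ 1ℤ ⊗ l
          ring = solve-∀

  a-per : IsPeriod a p
  a-per = proj₁ (proj₂ minimal)

  p∣n′ : p ∣ n′
  p∣n′ = minimalPeriod-∣ minimal a-periodic

  -- m is the mean of a over n - 1 terms, which consist of whole periods.
  ∑-a-p : ∑ a p ≡ m * p
  ∑-a-p with p∣n′
  ... | divides zero    n′≡ = contradiction (subst (2 ≤_) n′≡ 2≤n′) λ ()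
  ... | divides (suc c) n′≡ = ℕₚ.*-cancelˡ-≡ (∑ a p) (m * p) (suc c) (begin
    suc c * ∑ a p    ≡⟨ ∑-period-* a-per (suc c) ⟨
    ∑ a (suc c * p)  ≡⟨ cong (∑ a) n′≡ ⟨
    ∑ a n′           ≡⟨ ∑-cong n′ (λ _ → a-aFin) ⟩
    aSum hn σ        ≡⟨ total ⟩
    m * n′           ≡⟨ cong (m *_) n′≡ ⟩
    m * (suc c * p)  ≡⟨ ring m (suc c) p ⟩
    suc c * (m * p)  ∎)
    where
    open ≡-Reasoning
    ring : ∀ m c p → m * (c * p) ≡ c * (m * p)
    ring = solve-∀ℕ

  ∑-lenOf : ∀ y → ∑ (lenOf y ∘ a) p ≡ p * lenOf y m
  ∑-lenOf true  = trans ∑-a-p (ℕₚ.*-comm m p)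
  ∑-lenOf false = begin
    ∑ (λ i → n′ ∸ a i) p                    ≡⟨ ℕₚ.m+n∸m≡n (∑ a p) _ ⟨
    ∑ a p + ∑ (λ i → n′ ∸ a i) p ∸ ∑ a p    ≡⟨ cong₂ _∸_ both (trans ∑-a-p (ℕₚ.*-comm m p)) ⟩
    p * n′ ∸ p * m                          ≡⟨ ℕₚ.*-distribˡ-∸ p n′ m ⟨
    p * (n′ ∸ m)                            ∎
    where
    open ≡-Reasoning
    both : ∑ a p + ∑ (λ i → n′ ∸ a i) p ≡ p * n′
    both = trans (sym (∑-+ a (λ i → n′ ∸ a i) p)) (trans (∑-cong p λ i _ → ℕₚ.m+[n∸m]≡n (ℕₚ.<⇒≤ (a<n′ i))) (∑-const n′ p))

  ν : ℕ
  ν = ∑ (λ i → ⟨ not (Y (v i)) ⟩) n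

  ∑-Y : ∑ (λ i → ⟨ Y (v i) ⟩) n ≡ μ
  ∑-Y = trans (∑-walk (λ u → ⟨ Y u ⟩)) (sumᵥ-allFin (λ u → ⟨ Y u ⟩))

  μ+ν : μ + ν ≡ n
  μ+ν = begin
    μ + ν                                     ≡⟨ cong (_+ ν) ∑-Y ⟨
    ∑ (λ i → ⟨ Y (v i) ⟩) n + ν               ≡⟨ ∑-+ (λ i → ⟨ Y (v i) ⟩) (λ i → ⟨ not (Y (v i)) ⟩) n ⟨
    ∑ (λ i → ⟨ Y (v i) ⟩ + ⟨ not (Y (v i)) ⟩) n ≡⟨ ∑-cong n (λ i _ → complement (Y (v i))) ⟩
    ∑ (λ _ → 1) n                             ≡⟨ ∑-const 1 n ⟩
    n * 1                                     ≡⟨ ℕₚ.*-identityʳ n ⟩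
    n                                         ∎
    where
    open ≡-Reasoning
    complement : ∀ b → ⟨ b ⟩ + ⟨ not b ⟩ ≡ 1
    complement true  = refl
    complement false = refl

  ν≡n∸μ : ν ≡ n ∸ μ
  ν≡n∸μ = trans (sym (ℕₚ.m+n∸m≡n μ ν)) (cong (_∸ μ) μ+ν)

  ∑-by-part : ∀ (f : Bool → ℕ) k → ∑ (λ i → f (Y (v i))) k ≡
              ∑ (λ i → ⟨ Y (v i) ⟩) k * f true + ∑ (λ i → ⟨ not (Y (v i)) ⟩) k * f false
  ∑-by-part f zero    = refl
  ∑-by-part f (suc k) = trans (∑-suc (λ i → f (Y (v i))) k) (trans (cong (λ s → s + f (Y (v k))) (∑-by-part f k))
    (trans (go (Y (v k))) (sym (cong₂ (λ s t → s * f true + t * f false)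
      (∑-suc (λ i → ⟨ Y (v i) ⟩) k) (∑-suc (λ i → ⟨ not (Y (v i)) ⟩) k)))))
    where
    A = ∑ (λ i → ⟨ Y (v i) ⟩) k
    B = ∑ (λ i → ⟨ not (Y (v i)) ⟩) k
    ring₁ : ∀ A B x y → A * x + B * y + x ≡ (A + 1) * x + (B + 0) * y
    ring₁ = solve-∀ℕ
    ring₂ : ∀ A B x y → A * x + B * y + y ≡ (A + 0) * x + (B + 1) * y
    ring₂ = solve-∀ℕ
    go : ∀ y → A * f true + B * f false + f y ≡ (A + ⟨ y ⟩) * f true + (B + ⟨ not y ⟩) * f false
    go true  = ring₁ A B (f true) (f false)
    go false = ring₂ A B (f true) (f false)

  S : ℕ
  S = μ * m + (n ∸ μ) * (n′ ∸ m)

  -- Since n ≡ 1 modulo the period n − 1 of a, the index u n + s has vertex v_s and increment a_{u+s}.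
  ∑-len-round : ∑ len (p * n) ≡ p * S
  ∑-len-round = begin
    ∑ len (p * n)                                            ≡⟨ ∑-blocks len p n ⟩
    ∑ (λ u → ∑ (λ s → len (u * n + s)) n) p                  ≡⟨ ∑-cong p (λ u _ → ∑-cong n λ s _ → cong₂ lenOf (cong Y (v-block u s)) (a-block u s)) ⟩
    ∑ (λ u → ∑ (λ s → lenOf (Y (v s)) (a (u + s))) n) p      ≡⟨ ∑-comm (λ u s → lenOf (Y (v s)) (a (u + s))) p n ⟩
    ∑ (λ s → ∑ (λ u → lenOf (Y (v s)) (a (u + s))) p) n      ≡⟨ ∑-cong n (λ s _ → trans (∑-period-shift {lenOf (Y (v s)) ∘ a} (λ β → cong (lenOf (Y (v s))) (a-per β)) s) (∑-lenOf (Y (v s)))) ⟩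
    ∑ (λ s → p * lenOf (Y (v s)) m) n                        ≡⟨ ∑-by-part (λ y → p * lenOf y m) n ⟩
    ∑ (λ i → ⟨ Y (v i) ⟩) n * (p * m) + ν * (p * (n′ ∸ m))   ≡⟨ cong₂ (λ s t → s * (p * m) + t * (p * (n′ ∸ m))) ∑-Y ν≡n∸μ ⟩
    μ * (p * m) + (n ∸ μ) * (p * (n′ ∸ m))                   ≡⟨ ring μ (n ∸ μ) p m (n′ ∸ m) ⟩
    p * S                                                    ∎
    where
    open ≡-Reasoning
    ring : ∀ x y p a b → x * (p * a) + y * (p * b) ≡ p * (x * a + y * b)
    ring = solve-∀ℕ
    v-block : ∀ u s → v (u * n + s) ≡ v s
    v-block zero    s = refl
    v-block (suc u) s = trans (cong v (trans (ℕₚ.+-assoc n (u * n) s) (ℕₚ.+-comm n (u * n + s))))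
      (trans (v-periodic (u * n + s)) (v-block u s))
    a-block : ∀ u s → a (u * n + s) ≡ a (u + s)
    a-block u s = trans (cong a (split u s n′)) (period-* {a} a-periodic u (u + s))
      where split : ∀ u s m → u * suc m + s ≡ u + s + u * m
            split = solve-∀ℕ

  v-periodic-* : ∀ k β → v (β + k * n) ≡ v β
  v-periodic-* zero    β = cong v (ℕₚ.+-identityʳ β)
  v-periodic-* (suc k) β = trans (cong v (sym (ℕₚ.+-assoc β n (k * n)))) (trans (v-periodic-* k (β + n)) (v-periodic β))

  len-periodic : IsPeriod len (p * n)
  len-periodic β = cong₂ lenOf (cong Y (v-periodic-* p β))
    (trans (cong (λ k → a (β + k)) (ℕₚ.*-comm p n)) (period-* {a} a-per n β))

  time-∑ : ∀ β → time β ≡ ∑ len β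
  time-∑ zero    = refl
  time-∑ (suc β) = trans (cong (λ s → s + len β) (time-∑ β)) (sym (∑-suc len β))

  time-rounds : ∀ t → time (t * (p * n)) ≡ t * (p * S)
  time-rounds t = trans (time-∑ (t * (p * n))) (trans (∑-period-* len-periodic t) (cong (t *_) ∑-len-round))

  time>0 : ∀ {β} → 0 < β → 0 < time β
  time>0 {suc β} _ = ℕₚ.≤-trans (len>0 β) (ℕₚ.m≤n+m (len β) (time β))

  -- The increments add up to a multiple of n, and each of the t p ν downward carries contributes
  -- -(n - 1) ≡ 1.
  R-rounds : ∀ t → R (t * (p * n)) ≡ R 0 ⊕ + (t * p * ν) [mod n ]
  R-rounds t = multiple (+ (t * (m * p)) ⊖ + (t * p * ν)) (trans
    (cong₂ (λ A N → + label n′ ⊖ + n′ ⊕ A ⊖ + N ⊗ + n′) ∑-a ∑-N)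
    (ring (+ label n′) (+ n′) (+ (t * (m * p))) (+ (t * p * ν))))
    where
    ring : ∀ l m A N → l ⊖ m ⊕ (1ℤ ⊕ m) ⊗ A ⊖ N ⊗ m ≡ l ⊖ m ⊕ 0ℤ ⊖ 0ℤ ⊗ m ⊕ N ⊕ (A ⊖ N) ⊗ (1ℤ ⊕ m)
    ring = solve-∀
    turns : ∀ t p n → t * (p * n) ≡ n * t * p
    turns = solve-∀ℕ
    ∑-a : + ∑ a (t * (p * n)) ≡ + n ⊗ + (t * (m * p))
    ∑-a = trans (cong +_ (trans (cong (∑ a) (turns t p n)) (trans (∑-period-* a-per (n * t))
      (trans (cong (λ s → n * t * s) ∑-a-p) (ℕₚ.*-assoc n t (m * p)))))) (ℤₚ.pos-* n (t * (m * p)))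
    ∑-N : ∑ (λ i → ⟨ not (Y (v i)) ⟩) (t * (p * n)) ≡ t * p * ν
    ∑-N = trans (cong (∑ (λ i → ⟨ not (Y (v i)) ⟩)) (sym (ℕₚ.*-assoc t p n)))
      (∑-period-* (λ β → cong (λ u → ⟨ not (Y u) ⟩) (v-periodic β)) (t * p))

  Q-suc : ∀ β j → Q (β + suc j) ≡ Q (β + j) ⊕ + a (β + j) [mod n′ ]
  Q-suc β j = mod-cast (cong Q (ℕₚ.+-suc β j)) (q-step (β + j)) refl

  -- Q is determined modulo n − 1 by its increments a.
  Q-shift : ∀ {β} → (∀ j → a (β + j) ≡ a j) → ∀ j → Q (β + j) ⊖ Q j ≡ Q β ⊖ Q 0 [mod n′ ]
  Q-shift {β} _  zero    = mod-reflexive (cong (λ k → Q k ⊖ Q 0) (ℕₚ.+-identityʳ β))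
  Q-shift {β} a≡ (suc j) = mod-trans (mod-cast refl (mod-- (Q-suc β j) (q-step j))
      (trans (cong (λ x → Q (β + j) ⊕ + x ⊖ (Q j ⊕ + a j)) (a≡ j)) (ring (Q (β + j)) (Q j) (+ a j))))
    (Q-shift a≡ j)
    where ring : ∀ x y a → x ⊕ a ⊖ (y ⊕ a) ≡ x ⊖ y
          ring = solve-∀

  -- Carrier and increments recur after p n takeovers. All places then shift by `Q β ⊖ Q 0`, and so
  -- does the carrier because `R` lifts `Q`; the only condition left is the one on its label modulo
  -- n.
  rounds⇒same : ∀ t → n ∣ t * p * ν → Same (t * (p * n)) r₀ 0 r₀
  rounds⇒same t n∣ = same vertex
    (mod-cast (cong (λ ε → R β ⊕ ⟦ ε ⟧ ⊗ + r₀) sgn≡) (mod-+ʳ (⟦ sgn 0 ⟧ ⊗ + r₀)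
      (mod-trans (R-rounds t) (mod-cast refl (mod-+ˡ (R 0) (mod-∣ n∣)) (ℤₚ.+-identityʳ (R 0))))) refl)
    λ j _ _ → mod-exchange (Q (β + j)) (Q j) (X β r₀) (X 0 r₀) (mod-trans (Q-shift a≡ j) (mod-sym (mod-cast
      (trans (cong (λ ε → R β ⊕ ⟦ ε ⟧ ⊗ + r₀ ⊖ X 0 r₀) sgn≡) (ring (R β) (R 0) (⟦ sgn 0 ⟧ ⊗ + r₀)))
      (mod-- (R-Q β) (R-Q 0)) refl)))
    where
    β = t * (p * n)
    vertex : v β ≡ v 0
    vertex = trans (cong v (sym (ℕₚ.*-assoc t p n))) (v-periodic-* (t * p) 0)
    sgn≡ : sgn β ≡ sgn 0
    sgn≡ = cong (λ u → signOf (Y u)) vertex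
    a≡ : ∀ j → a (β + j) ≡ a j
    a≡ j = trans (cong a (trans (ℕₚ.+-comm β j) (cong (λ k → j + k) (turns t p n)))) (period-* {a} a-per (t * n) j)
      where turns : ∀ t p n → t * (p * n) ≡ t * n * p
            turns = solve-∀ℕ
    ring : ∀ R R₀ e → R ⊕ e ⊖ (R₀ ⊕ e) ≡ R ⊖ R₀
    ring = solve-∀

  -- Equal carriers give β = b n. Uniformly shifted places have equal increments, so β is a period
  -- of a and p divides b n = b (n - 1) + b, hence b.
  same⇒rounds : ∀ {β r} → r < len β → Same β r 0 r₀ → ∃[ t ] β ≡ t * (p * n) × r ≡ r₀ × n ∣ t * p * ν
  same⇒rounds {β} {r} r<len (same vertex origin spots) = go (v-≡⇒∣ 0 β vertex)
    where
    C = X β r ⊖ X 0 r₀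
    Q-shifted⁺ : ∀ {j} → 1 ≤ j → j ≤ n′ → Q (β + j) ⊖ Q j ≡ C [mod n′ ]
    Q-shifted⁺ {j} 1≤j j≤n′ = mod-exchange (Q (β + j)) (X β r) (Q j) (X 0 r₀) (spots j 1≤j j≤n′)
    Q-shifted : ∀ {j} → j ≤ n′ → Q (β + j) ⊖ Q j ≡ C [mod n′ ]
    Q-shifted {suc j} j≤n′ = Q-shifted⁺ (s≤s z≤n) j≤n′
    -- Index 0 belongs to the carrier, which is not at rest; by the period of `Q` its place is the
    -- one with index n - 1.
    Q-shifted {zero}  _    = mod-cast (cong₂ (λ x y → + x ⊖ + y)
        (trans (cong q (ℕₚ.+-identityʳ β)) (sym (q-periodic β))) (sym (q-periodic 0)))
      (Q-shifted⁺ (ℕₚ.≤-trans (s≤s z≤n) 2≤n′) ℕₚ.≤-refl) refl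
    a≡-below : ∀ {j} → j < n′ → a (β + j) ≡ a j
    a≡-below {j} j<n′ = mod-small (a<n′ (β + j)) (a<n′ j)
      (mod-cast (ring (+ a (β + j)) (+ a j)) (mod-+ʳ (+ a j) (mod-+-cancelˡ C
        (mod-trans (mod-sym (mod-trans (mod-- (Q-suc β j) (q-step j))
            (mod-cast (ring′ (Q (β + j)) (Q j) (+ a (β + j)) (+ a j))
              (mod-+ʳ (+ a (β + j) ⊖ + a j) (Q-shifted (ℕₚ.<⇒≤ j<n′))) refl)))
          (mod-cast refl (Q-shifted j<n′) (sym (ℤₚ.+-identityʳ C))))))
        (ℤₚ.+-identityˡ (+ a j)))
      where ring : ∀ x y → x ≡ x ⊖ y ⊕ y
            ring = solve-∀
            ring′ : ∀ x y a b → x ⊕ a ⊖ (y ⊕ b) ≡ x ⊖ y ⊕ (a ⊖ b)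
            ring′ = solve-∀
    a≡ : IsPeriod a β
    a≡ j = trans (cong a (trans (cong (λ k → k + β) (ℕ.m≡m%n+[m/n]*n j n′)) (reorder (j ℕ.% n′) (j ℕ./ n′ * n′) β)))
      (trans (period-* {a} a-periodic (j ℕ./ n′) (β + j ℕ.% n′)) (trans (a≡-below (ℕ.m%n<n j n′))
        (cong (aFin hn σ) (ℕ.m%n%n≡m%n j n′))))
      where reorder : ∀ x y b → x + y + b ≡ b + x + y
            reorder = solve-∀ℕ
    sgn≡ : sgn β ≡ sgn 0
    sgn≡ = cong (λ u → signOf (Y u)) vertex
    r≡r₀ : r ≡ r₀
    -- At index 0 the common shift `C` is `Q β ⊖ Q 0`, congruent to `R β ⊖ R 0`; so r and r₀ agree
    -- modulo n - 1, and both are smaller.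
    r≡r₀ = mod-small (ℕₚ.<-trans r<len (len<n′ β)) (ℕₚ.<-trans r₀<len (len<n′ 0))
      (⟦⟧-cancel (sgn 0) (mod-cast (trans (cong (λ ε → ⟦ ε ⟧ ⊗ + r) (sym sgn≡)) (ring (R β) (⟦ sgn β ⟧ ⊗ + r)))
        (mod-exchange (X β r) (X 0 r₀) (R β) (R 0) (mod-trans (mod-sym (Q-shifted z≤n)) (mod-cast (cong (λ k → Q k ⊖ Q 0) (ℕₚ.+-identityʳ β))
          (mod-- (mod-sym (R-Q β)) (mod-sym (R-Q 0))) refl)))
        (sym (ring (R 0) (⟦ sgn 0 ⟧ ⊗ + r₀)))))
      where ring : ∀ R e → e ≡ R ⊕ e ⊖ R
            ring = solve-∀
    R≡ : R β ≡ R 0 [mod n ]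
    R≡ = mod-cast (trans (ring (R β) (⟦ sgn 0 ⟧ ⊗ + r₀)) (cong₂ (λ ε r → R β ⊕ ⟦ ε ⟧ ⊗ + r ⊖ ⟦ sgn 0 ⟧ ⊗ + r₀) (sym sgn≡) (sym r≡r₀)))
      (mod-+ʳ (⊝ (⟦ sgn 0 ⟧ ⊗ + r₀)) origin) (sym (ring (R 0) (⟦ sgn 0 ⟧ ⊗ + r₀)))
      where ring : ∀ R e → R ≡ R ⊕ e ⊖ e
            ring = solve-∀
    go : n ∣ β → ∃[ t ] β ≡ t * (p * n) × r ≡ r₀ × n ∣ t * p * ν
    go (divides b β≡) = finish (∣m+n∣m⇒∣n
      (subst (p ∣_) (trans β≡ (trans (ℕₚ.*-suc b n′) (ℕₚ.+-comm b (b * n′)))) (minimalPeriod-∣ minimal a≡)) (∣n⇒∣m*n b p∣n′))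
      where
      finish : p ∣ b → ∃[ t ] β ≡ t * (p * n) × r ≡ r₀ × n ∣ t * p * ν
      finish (divides t b≡) = t , β≡′ , r≡r₀ , ∣-mod (mod-+-cancelˡ (R 0) (mod-trans (mod-sym (R-rounds t))
        (mod-cast (cong R (sym β≡′)) R≡ (sym (ℤₚ.+-identityʳ (R 0))))))
        where
        β≡′ : β ≡ t * (p * n)
        β≡′ = trans β≡ (trans (cong (_* n) b≡) (ℕₚ.*-assoc t p n))

  -- The order of the rotation

  module _ (g w : ℕ) .{{_ : NonZero g}} (n≡wg : n ≡ w * g) (g∣μ : g ∣ μ)
    (g-greatest : ∀ t → n ∣ t * μ → n ∣ t * g) where

    n∣wν : n ∣ w * ν
    n∣wν = ∣m+n∣m⇒∣n (subst (n ∣_) (trans (cong (w *_) (sym μ+ν)) (ℕₚ.*-distribˡ-+ w μ ν)) (n∣m*n w)) n∣wμ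
      where
      ring : ∀ w k g → w * (k * g) ≡ k * (w * g)
      ring = solve-∀ℕ
      n∣wμ : n ∣ w * μ
      n∣wμ = let divides k μ≡ = g∣μ in divides k (trans (cong (w *_) μ≡) (trans (ring w k g) (cong (k *_) (sym n≡wg))))

    -- As μ + ν = n, ν may be replaced by μ. The factor p is removed on multiplying by c = (n - 1) /
    -- p, because c p ≡ -1 modulo n.
    n∣⇒w∣ : ∀ t → n ∣ t * p * ν → w ∣ t
    n∣⇒w∣ t n∣ = *-cancelʳ-∣ g (subst (_∣ t * g) n≡wg (g-greatest t n∣tμ))
      where
      n∣tpμ : n ∣ t * p * μ
      n∣tpμ = ∣m+n∣m⇒∣n (subst (n ∣_) (trans (cong (t * p *_) (trans (sym μ+ν) (ℕₚ.+-comm μ ν))) (ℕₚ.*-distribˡ-+ (t * p) ν μ)) (n∣m*n (t * p))) n∣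
      n∣tμn′ : n ∣ t * μ * n′
      n∣tμn′ with p∣n′
      ... | divides c n′≡ = subst (n ∣_) (trans (ring c t p μ) (cong (t * μ *_) (sym n′≡))) (∣n⇒∣m*n c n∣tpμ)
        where ring : ∀ c t p μ → c * (t * p * μ) ≡ t * μ * (c * p)
              ring = solve-∀ℕ
      n∣tμ : n ∣ t * μ
      n∣tμ = ∣m+n∣m⇒∣n (subst (n ∣_) (trans (ℕₚ.*-suc (t * μ) n′) (ℕₚ.+-comm (t * μ) (t * μ * n′))) (n∣m*n (t * μ))) n∣tμn′

    size : n * p / g * S ≡ time (w * (p * n))
    size = begin
      n * p / g * S        ≡⟨ cong (λ k → k / g * S) (trans (cong (_* p) n≡wg) (ring w g p)) ⟩
      w * p * g / g * S    ≡⟨ cong (_* S) (ℕ.m*n/n≡m (w * p) g) ⟩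
      w * p * S            ≡⟨ ℕₚ.*-assoc w p S ⟩
      w * (p * S)          ≡⟨ time-rounds w ⟨
      time (w * (p * n))   ∎
      where
      open ≡-Reasoning
      ring : ∀ w g p → w * g * p ≡ w * p * g
      ring = solve-∀ℕ

    w>0 : 0 < w
    w>0 = ℕₚ.n≢0⇒n>0 λ w≡0 → contradiction (trans n≡wg (cong (_* g) w≡0)) λ ()

    p>0 : 0 < p
    p>0 = proj₁ minimal

    pn>0 : 0 < p * n
    pn>0 = ℕₚ.*-mono-≤ p>0 (s≤s (z≤n {n′}))

    orbit-size : OrbitSize refr start (n * p / g * S)
    orbit-size = subst (OrbitSize refr start) (sym size) (time>0 (ℕₚ.*-mono-≤ w>0 pn>0) , returns , first)
      where
      N = time (w * (p * n))
      returns : iter (Θ refr) N start ≈Ξ start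
      returns =
        let β , r , r<len , elapsed , s = reach start r₀<len start-state N
            -- β = w p n and r = r₀ solve the clock equation at time `N`, so the state reached there
            -- is the one with these indices.
            β≡ , r≡ = time-unique r<len (subst (r₀ <_) (sym (period-* len-periodic w 0)) r₀<len) elapsed
        in same⇒≈ _ start (subst₂ (λ β r → StateOf β r (iter (Θ refr) N start)) β≡ r≡ s) start-state
             (rounds⇒same w (subst (n ∣_) (ring w ν p) (∣m⇒∣m*n p n∣wν)))
        where ring : ∀ w ν p → w * ν * p ≡ w * p * ν
              ring = solve-∀ℕ
      first : ∀ k → 0 < k → k < N → ¬ (iter (Θ refr) k start ≈Ξ start)
      first k 0<k k<N back =
        let β , r , r<len , elapsed , s = reach start r₀<len start-state k
            t , β≡ , r≡ , n∣ = same⇒rounds r<len (≈⇒same _ start s start-state back)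
        in late t n∣ (ℕₚ.+-cancelʳ-≡ r₀ (time (t * (p * n))) k (trans (sym (cong₂ (λ β r → time β + r) β≡ r≡)) elapsed))
        where
        late : ∀ t → n ∣ t * p * ν → time (t * (p * n)) ≡ k → ⊥
        late zero    _  k≡ = ℕₚ.<⇒≢ 0<k k≡
        late (suc t) n∣ k≡ = ℕₚ.<⇒≱ k<N (subst₂ _≤_ (sym (time-rounds w)) (trans (sym (time-rounds (suc t))) k≡)
          (ℕₚ.*-monoˡ-≤ (p * S) (∣⇒≤ (n∣⇒w∣ (suc t) n∣))))

theorem1p6 : (n : ℕ) (hn : 3 ≤ n) (refr : Fin n → Bool) → 2 ∣ count refr →
    (σ : Permutation′ n) →
    (p : ℕ) → IsMinimalPeriod (aSeq hn σ) p →
    (m : ℕ) → aSum hn σ ≡ m * (n ∸ 1) →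
    (Y : Fin n → Bool) → IsSignPartition hn refr σ Y →
    OrbitSize refr (σ , one hn , pos)
    (_/_ (n * p) (gcd n (count Y)) {{nz-gcd hn (count Y)}}
    * (count Y * m + (n ∸ count Y) * (n ∸ 1 ∸ m)))
theorem1p6 (suc n′) hn refr _ σ p minimal m total Y partition with gcd[m,n]∣m (suc n′) (count Y)
... | divides w n≡wg = Orbit.orbit-size hn refr σ p minimal m total Y partition
  (gcd (suc n′) (count Y)) w {{nz-gcd hn (count Y)}} n≡wg (gcd[m,n]∣n (suc n′) (count Y))
  -- t gcd(n, μ) = gcd(t n, t μ), and n divides both arguments.
  λ t n∣tμ → subst (suc n′ ∣_) (sym (c*gcd[m,n]≡gcd[cm,cn] t (suc n′) (count Y))) (gcd-greatest (n∣m*n t) n∣tμ)
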